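{- Let $k,n$ be positive integers with $\gcd(k,n)=1$. If $k\equiv\pm 2\pmod n$, then for every pair of distinct nonzero $v_1,v_2\in\mathbb{F}_{2^n}$, $$\bigl|\{(x,y,z)\in\Delta^3:\ v_1x+v_2y+(v_1+v_2)z=0\}\bigr|=2^{2n-3}.$$ Together with the case $k\equiv\pm1\pmod n$, the same equality (for all distinct nonzero $v_1,v_2$) holds whenever $\gcd(k,n)=1$ and $k$ is congruent modulo $n$ to one of $1,\,2,\,n-2,\,n-1$.
   Context: $\mathbb{F}_{2^n}$ is the field with $2^n$ elements. For positive integers $k,n$ put $F(x)=x^{4^k-2^k+1}$ for $x\in\mathbb{F}_{2^n}$, $\delta(b)=F(b)+F(b+1)+1$, and $\Delta=\{\delta(b): b\in\mathbb{F}_{2^n}\}$. -}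

module Defs where

open import Algebra.Apartness.Bundles using (HeytingField; HeytingCommutativeRing)
open import Algebra.Bundles using (CommutativeRing)
open import Data.Fin.Base using (Fin)
open import Data.Integer.Base using (ℤ; +_; _-_)
open import Data.Integer.Divisibility using (_∣_)
open import Data.Nat.Base as ℕ using (ℕ; _∸_)
open import Data.Product.Base using (Σ; ∃-syntax; _×_; _,_; proj₁)
open import Data.Product.Relation.Binary.Pointwise.NonDependent using (×-setoid)
open import Function.Bundles using (Inverse)
open import Level using (Level; _⊔_)
open import Relation.Binary.Bundles using (Setoid)
import Relation.Binary.Construct.On as On
import Relation.Binary.PropositionalEquality.Properties as ≡
open import Relation.Unary using (Pred; _∈_)

infix 4 _≡_[mod_]

_≡_[mod_] : ℤ → ℤ → ℕ → Set
a ≡ b [mod n ] = + n ∣ (a - b)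

HasCardinality : {a ℓ : Level} → Setoid a ℓ → ℕ → Set (a ⊔ ℓ)
HasCardinality S N = Inverse (≡.setoid (Fin N)) S

-- Elements are compared in S only: membership proofs are ignored, so that
-- counting the subset does not count the ways of belonging to it.
Subset : {a ℓ p : Level} (S : Setoid a ℓ) → Pred (Setoid.Carrier S) p → Setoid (a ⊔ p) ℓ
Subset S P = On.setoid {B = Σ (Setoid.Carrier S) P} S proj₁

commutativeRing : {c ℓ₁ ℓ₂ : Level} → HeytingField c ℓ₁ ℓ₂ → CommutativeRing c ℓ₁
commutativeRing K =
  HeytingCommutativeRing.commutativeRing (HeytingField.heytingCommutativeRing K)

-- A field with 2ⁿ elements is a Heyting field whose carrier setoid has
-- cardinality 2ⁿ.  On a finite field equality is decidable, so the apartness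
-- relation is just the negation of equality.
module Kasami {c ℓ₁ ℓ₂ : Level} (K : HeytingField c ℓ₁ ℓ₂) (k : ℕ) where

  open CommutativeRing (commutativeRing K)
  open import Algebra.Properties.Semiring.Exp semiring using (_^_)

  -- The truncated subtraction is exact, since 2ᵏ ≤ 4ᵏ.
  F : Carrier → Carrier
  F x = x ^ ((4 ℕ.^ k ∸ 2 ℕ.^ k) ℕ.+ 1)

  δ : Carrier → Carrier
  δ b = F b + F (b + 1#) + 1#

  Δ : Pred Carrier (c ⊔ ℓ₁)
  Δ x = ∃[ b ] x ≈ δ b

  Solution : Carrier → Carrier → Pred (Carrier × Carrier × Carrier) (c ⊔ ℓ₁)
  Solution v₁ v₂ (x , y , z) =
    (x ∈ Δ × y ∈ Δ × z ∈ Δ) × v₁ * x + v₂ * y + (v₁ + v₂) * z ≈ 0#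

  -- The truncated 2n ∸ 3 differs from 2n - 3 only for n ≤ 1, where the
  -- field has no two distinct nonzero elements.
  CountEquality : ℕ → Set (c ⊔ ℓ₁)
  CountEquality n =
    (v₁ v₂ : Carrier) → v₁ ≉ 0# → v₂ ≉ 0# → v₁ ≉ v₂ →
    HasCardinality
      (Subset (×-setoid setoid (×-setoid setoid setoid)) (Solution v₁ v₂))
      (2 ℕ.^ (2 ℕ.* n ∸ 3))

{-# OPTIONS --safe #-}

-- Since x ^ 2ⁿ = x, only k mod n matters, and k and -k give the same Δ because
-- they differ by a power of Frobenius; so k may be replaced by j = 1 or 2.  Then
-- Δ is the image of g w = w^e + w^(e+1), where e = 1 for j = 1 and e = 5 for
-- j = 2, and g is exactly two-to-one: for e = 5 there is no primitive cube root
-- of unity (n is odd), distinct x and y with g x = g y satisfy Tr (x + y) = 1, so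
-- no three points collide, and the colliding pairs are parametrised rationally.
--
-- Hence 8 N is the number M of w ∈ K³ with A w + B w = 0, where
-- A w = Σ vᵢ wᵢ^e and B w = Σ vᵢ wᵢ^(e+1).  As A and B are homogeneous of
-- consecutive degrees, A w + r B w = 0 has M solutions w for every r ≠ 0.
-- Counting the pairs (r, w) in two ways, where A and B have Q² zeros each
-- (Q = 2ⁿ) and only the Q diagonal points in common, gives M = Q².
module Submission where

open import Defs
open import Algebra.Apartness.Bundles using (HeytingField)
open import Algebra.Bundles using (CommutativeMonoid; CommutativeRing; RawRing)
import Algebra.Properties.CommutativeMonoid.Sum as Sum
import Algebra.Properties.CommutativeSemiring.Exp as Exp
import Algebra.Properties.Monoid.Mult as Mult
import Algebra.Properties.Ring as RingProperties
import Algebra.Properties.Semiring.Mult as SemiringMult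
import Algebra.Properties.Semiring.Sum as SemiringSum
import Algebra.Solver.Ring as RingSolver
open import Algebra.Solver.Ring.AlmostCommutativeRing
  using (AlmostCommutativeRing; _-Raw-AlmostCommutative⟶_; Induced-equivalence; fromCommutativeRing)
open import Data.Bool.Base using (Bool; true; false)
import Data.Bool.Properties as Bool
open import Data.Fin.Base as Fin using (Fin; zero; suc; combine; remQuot; punchIn; punchOut; _↑ˡ_; _↑ʳ_)
open import Data.Fin.Permutation using (Permutation′; permutation)
import Data.Fin.Properties as Fin
open import Data.Integer.Base as ℤ using (+_)
import Data.Integer.Divisibility.Signed as Signed
import Data.Integer.Properties as ℤ
open import Data.Integer.Tactic.RingSolver using (solve-∀)
open import Data.Maybe.Base using (just; nothing)
open import Data.Nat.Base as ℕ using (ℕ; zero; suc; _∸_)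
open import Data.Nat.Divisibility using (divides; _∣?_)
open import Data.Nat.GCD using (gcd; module Bézout; gcd-GCD; module GCD)
import Data.Nat.Properties as ℕ
open import Data.Nat.Solver using (module +-*-Solver)
open import Data.Product.Base using (Σ; ∃-syntax; _×_; _,_; proj₁; proj₂)
open import Data.Product.Function.NonDependent.Setoid using (_×-inverse_)
open import Data.Product.Relation.Binary.Pointwise.NonDependent using (×-setoid; Pointwise-≡↔≡)
open import Data.Sum.Base using (_⊎_; inj₁; inj₂; [_,_]′)
open import Function.Base using (_∘_)
open import Function.Bundles using (Inverse)
import Function.Construct.Composition as Compose
import Function.Construct.Symmetry as Symmetry
open import Function.Definitions using (Congruent; Injective)
open import Level using (Level)
open import Relation.Binary.Bundles using (Setoid)
import Relation.Binary.Definitions as B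
open import Relation.Binary.PropositionalEquality.Core as ≡ using (_≡_; _≢_)
import Relation.Binary.PropositionalEquality.Properties as ≡
import Relation.Binary.Reasoning.Setoid as SetoidReasoning
open import Relation.Nullary using (¬_; Dec; yes; no; contradiction)
open import Relation.Nullary.Decidable using (_×-dec_; map′; toWitnessFalse)
open import Relation.Unary using (Pred; Decidable)

-- That `A` and `B` share only diagonal zeros is a statement about collinear points. The weights v₁,
-- v₂, v₁ + v₂ add up to 0, so A w = B w = 0 is an affine dependence between the three points (wᵢ^e,
-- wᵢ^(e+1)) of the plane. Unless they coincide they lie on a line t^(e+1) + d t^e = const, with d ≠
-- 0 because t ↦ t^(e+1) is injective. Rescaling t by 1/d makes g take one value at three points, so
-- two of them agree, and as all weights are nonzero the third agrees too. Homogeneity thus works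
-- twice: for the scalar r and for the slope d.
--
-- For j = 2 the obstacle is that δ b = g (b² + b + 1) evaluates g on half of the field only, a
-- coset of the group of all b² + b. Distinct x and y with g x = g y have x + y + 1 in that group,
-- while 1 is outside it; so the two preimages of a value lie in different cosets, and the half
-- reached by δ already gives every value of g.

-- Counting decidable subsets and summing over finite setoids.

module Cardinality where

  private
    variable
      a ℓ p q : Level
      P Q : Set p
      m n N : ℕ

  open Sum ℕ.+-0-commutativeMonoid public using () renaming (sum to ∑ℕ; sum-cong-≗ to ∑ℕ-cong)

  ι : Dec P → ℕ
  ι (yes _) = 1
  ι (no  _) = 0

  ι-cong : (P? : Dec P) (Q? : Dec Q) → (P → Q) → (Q → P) → ι P? ≡ ι Q?
  ι-cong (yes _) (yes _) _ _ = ≡.refl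
  ι-cong (yes p) (no ¬q) f _ = contradiction (f p) ¬q
  ι-cong (no ¬p) (yes q) _ g = contradiction (g q) ¬p
  ι-cong (no _)  (no _)  _ _ = ≡.refl

  ι-yes : (P? : Dec P) → P → ι P? ≡ 1
  ι-yes (yes _) _ = ≡.refl
  ι-yes (no ¬p) p = contradiction p ¬p

  ι-no : (P? : Dec P) → ¬ P → ι P? ≡ 0
  ι-no (yes p) ¬p = contradiction p ¬p
  ι-no (no _)  _  = ≡.refl

  ι-× : {p q : Level} {P : Set p} {Q : Set q} (P? : Dec P) (Q? : Dec Q) → ι (P? ×-dec Q?) ≡ ι P? ℕ.* ι Q?
  ι-× (yes _) (yes _) = ≡.refl
  ι-× (yes _) (no _)  = ≡.refl
  ι-× (no _)  _       = ≡.refl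

  private
    Fin-setoid : ℕ → Setoid _ _
    Fin-setoid = ≡.setoid ∘ Fin

    extend-yes : {P : Pred (Fin (suc N)) p} → P zero →
                 HasCardinality (Subset (Fin-setoid N) (P ∘ suc)) n →
                 HasCardinality (Subset (Fin-setoid (suc N)) P) (suc n)
    extend-yes {N = N} {n = n} {P = P} p₀ I = record
      { to        = to
      ; from      = from
      ; to-cong   = λ { ≡.refl → ≡.refl }
      ; from-cong = λ {x} {y} → from-cong x y
      ; inverse   = (λ {x} {y} → invˡ x y) , (λ {i} {y} → invʳ i y)
      }
      where
      module I = Inverse I
      to : Fin (suc n) → Σ (Fin (suc N)) P
      to zero    = zero , p₀
      to (suc j) = let (i , p) = I.to j in suc i , p
      from : Σ (Fin (suc N)) P → Fin (suc n)
      from (zero  , _) = zero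
      from (suc i , p) = suc (I.from (i , p))
      from-cong : ∀ x y → proj₁ x ≡ proj₁ y → from x ≡ from y
      from-cong (zero  , _) (.zero    , _) ≡.refl = ≡.refl
      from-cong (suc i , _) (.(suc i) , _) ≡.refl = ≡.cong suc (I.from-cong ≡.refl)
      invˡ : ∀ x y → y ≡ from x → proj₁ (to y) ≡ proj₁ x
      invˡ (zero  , _) _ ≡.refl = ≡.refl
      invˡ (suc i , _) _ ≡.refl = ≡.cong suc (I.inverseˡ ≡.refl)
      invʳ : ∀ i y → proj₁ y ≡ proj₁ (to i) → from y ≡ i
      invʳ zero    (zero  , _) _  = ≡.refl
      invʳ (suc i) (suc j , _) eq = ≡.cong suc (I.inverseʳ (Fin.suc-injective eq))

    extend-no : {P : Pred (Fin (suc N)) p} → ¬ P zero →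
                HasCardinality (Subset (Fin-setoid N) (P ∘ suc)) n →
                HasCardinality (Subset (Fin-setoid (suc N)) P) n
    extend-no {N = N} {n = n} {P = P} ¬p₀ I = record
      { to        = to
      ; from      = from
      ; to-cong   = λ { ≡.refl → ≡.refl }
      ; from-cong = λ {x} {y} → from-cong x y
      ; inverse   = (λ {x} {y} → invˡ x y) , (λ {i} {y} → invʳ i y)
      }
      where
      module I = Inverse I
      to : Fin n → Σ (Fin (suc N)) P
      to j = let (i , p) = I.to j in suc i , p
      from : Σ (Fin (suc N)) P → Fin n
      from (zero  , p) = contradiction p ¬p₀
      from (suc i , p) = I.from (i , p)
      from-cong : ∀ x y → proj₁ x ≡ proj₁ y → from x ≡ from y
      from-cong (zero  , p) _              _      = contradiction p ¬p₀
      from-cong (suc i , _) (.(suc i) , _) ≡.refl = I.from-cong ≡.refl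
      invˡ : ∀ x y → y ≡ from x → proj₁ (to y) ≡ proj₁ x
      invˡ (zero  , p) _ _      = contradiction p ¬p₀
      invˡ (suc i , _) _ ≡.refl = ≡.cong suc (I.inverseˡ ≡.refl)
      invʳ : ∀ i y → proj₁ y ≡ proj₁ (to i) → from y ≡ i
      invʳ i (zero  , p) _  = contradiction p ¬p₀
      invʳ i (suc j , _) eq = I.inverseʳ (Fin.suc-injective eq)

    -- Induction on `N`, split on whether `zero` is a member. The inverse laws never compare
    -- membership proofs, because `Subset` compares first components only.
    card-Fin-subset : {P : Pred (Fin N) p} (P? : Decidable P) →
                      HasCardinality (Subset (Fin-setoid N) P) (∑ℕ (ι ∘ P?))
    card-Fin-subset {N = zero} P? = record
      { to = λ () ; from = λ () ; to-cong = λ { {()} } ; from-cong = λ { {() , _} }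
      ; inverse = (λ { {() , _} }) , λ { {()} } }
    card-Fin-subset {N = suc N} P? with P? zero
    ... | yes p₀ = extend-yes p₀ (card-Fin-subset (P? ∘ suc))
    ... | no ¬p₀ = extend-no ¬p₀ (card-Fin-subset (P? ∘ suc))

  -- The round trip through `Fin N` returns an element only up to `_≈_`; `resp` carries the
  -- membership proof along.
  card-subset : {S : Setoid a ℓ} (fin : HasCardinality S N)
                {P : Pred (Setoid.Carrier S) p} (P? : Decidable P) →
                P B.Respects (Setoid._≈_ S) →
                HasCardinality (Subset S P) (∑ℕ (ι ∘ P? ∘ Inverse.to fin))
  card-subset {S = S} fin {P} P? resp =
    Compose.inverse (card-Fin-subset (P? ∘ to)) (record
      { to        = λ (i , p) → to i , p
      ; from      = λ (x , p) → from x , resp (sym (strictlyInverseˡ x)) p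
      ; to-cong   = to-cong
      ; from-cong = from-cong
      ; inverse   = inverseˡ , inverseʳ
      })
    where
    open Setoid S using (sym)
    open Inverse fin

  card-× : {b ℓ′ : Level} {S : Setoid a ℓ} {T : Setoid b ℓ′} →
           HasCardinality S m → HasCardinality T n →
           HasCardinality (×-setoid S T) (m ℕ.* n)
  card-× {m = m} {n = n} I J = Compose.inverse
    (Compose.inverse Fin.*↔× (Symmetry.inverse Pointwise-≡↔≡))
    (I ×-inverse J)

  ∑-++ : ∀ m (f : Fin (m ℕ.+ n) → ℕ) → ∑ℕ f ≡ ∑ℕ (λ i → f (i ↑ˡ n)) ℕ.+ ∑ℕ (λ j → f (m ↑ʳ j))
  ∑-++ zero    f = ≡.refl
  ∑-++ (suc m) f = ≡.trans (≡.cong (f zero ℕ.+_) (∑-++ m (f ∘ suc))) (≡.sym (ℕ.+-assoc (f zero) _ _))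

  ∑-combine : ∀ m n (f : Fin (m ℕ.* n) → ℕ) → ∑ℕ f ≡ ∑ℕ (λ i → ∑ℕ (λ j → f (combine {m} {n} i j)))
  ∑-combine zero    n f = ≡.refl
  ∑-combine (suc m) n f = ≡.trans (∑-++ n f)
      (≡.cong (∑ℕ (λ j → f (j ↑ˡ m ℕ.* n)) ℕ.+_) (∑-combine m n (λ j → f (n ↑ʳ j))))

  -- `card-×` enumerates a product through `remQuot`, so this form splits a sum over an enumerated
  -- product.
  ∑-remQuot : ∀ m n (f : Fin m × Fin n → ℕ) → ∑ℕ (f ∘ remQuot {m} n) ≡ ∑ℕ (λ i → ∑ℕ (λ j → f (i , j)))
  ∑-remQuot m n f = ≡.trans (∑-combine m n _)
    (∑ℕ-cong λ i → ∑ℕ-cong λ j → ≡.cong f (Fin.remQuot-combine {m} {n} i j))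


  -- If `j` were missed, punching it out of the codomain would inject `Fin (suc n)` into `Fin n`.
  -- Searching all `i` first keeps the argument constructive.
  Fin-injective⇒surjective : {f : Fin n → Fin n} → Injective _≡_ _≡_ f → ∀ j → ∃[ i ] f i ≡ j
  Fin-injective⇒surjective {n = suc n} {f} inj j with Fin.any? (λ i → f i Fin.≟ j)
  ... | yes hit  = hit
  ... | no  miss = contradiction (Fin.injective⇒≤ {f = λ i → punchOut (avoid i)}
                     (λ eq → inj (Fin.punchOut-injective (avoid _) (avoid _) eq))) ℕ.1+n≰n
    where
    avoid : ∀ i → j ≢ f i
    avoid i eq = miss (i , ≡.sym eq)

  module Finite {S : Setoid a ℓ} (fin : HasCardinality S N) where

    open Setoid S renaming (Carrier to A)
    open Inverse fin public using () renaming (to to element; from to index)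
    open Inverse fin using (to-cong; from-cong; strictlyInverseˡ; strictlyInverseʳ)

    infix 4 _≟_
    opaque
      _≟_ : B.Decidable _≈_
      x ≟ y = map′ (λ eq → trans (sym (strictlyInverseˡ x)) (trans (to-cong eq) (strictlyInverseˡ y)))
                   from-cong (index x Fin.≟ index y)

    any? : {P : Pred A p} → Decidable P → P B.Respects _≈_ → Dec (∃[ x ] P x)
    any? P? resp = map′ (λ (i , p) → element i , p)
                        (λ (x , p) → index x , resp (sym (strictlyInverseˡ x)) p)
                        (Fin.any? (P? ∘ element))

    private
      onIndex : (A → A) → Fin N → Fin N
      onIndex f = index ∘ f ∘ element

      onIndex-injective : {f : A → A} → Injective _≈_ _≈_ f → Injective _≡_ _≡_ (onIndex f)
      onIndex-injective f-inj eq = ≡.trans (≡.sym (strictlyInverseʳ _))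
        (≡.trans (from-cong (f-inj (trans (sym (strictlyInverseˡ _))
            (trans (to-cong eq) (strictlyInverseˡ _)))))
                 (strictlyInverseʳ _))

    injective⇒surjective : {f : A → A} → Injective _≈_ _≈_ f → ∀ y → ∃[ x ] f x ≈ y
    injective⇒surjective f-inj y =
      let (i , eq) = Fin-injective⇒surjective (onIndex-injective f-inj) (index y)
      in element i , trans (sym (strictlyInverseˡ _)) (trans (to-cong eq) (strictlyInverseˡ y))

    private
      toPermutation : (f : A → A) → Injective _≈_ _≈_ f → Permutation′ N
      toPermutation f f-inj = permutation (onIndex f) (proj₁ ∘ surj) (proj₂ ∘ surj)
        (λ i → onIndex-injective f-inj (proj₂ (surj _)))
        where surj = Fin-injective⇒surjective (onIndex-injective f-inj)

    module BigOp {b ℓ′} (M : CommutativeMonoid b ℓ′) where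

      open CommutativeMonoid M using (ε; _∙_; ∙-congˡ; identityʳ)
        renaming (Carrier to C; _≈_ to _≈′_; trans to trans′; sym to sym′)
      open Sum M using
        ( sum; sum-cong-≋; sum-remove; sum-permute; sum-replicate; sum-replicate-zero
        ; ∑-distrib-+; ∑-comm)
      open Mult (CommutativeMonoid.monoid M) using () renaming (_×_ to _⊗_)

      private
        sum-single : ∀ {n} (f : Fin n → C) i → (∀ j → j ≢ i → f j ≈′ ε) → sum f ≈′ f i
        sum-single {n = suc n} f i away = trans′ (sum-remove {i = i} f)
          (trans′ (∙-congˡ (trans′ (sum-cong-≋ λ j → away (punchIn i j) (Fin.punchInᵢ≢i i j))
              (sum-replicate-zero n)))
                  (identityʳ (f i)))

      -- Opaque, so that f can be inferred from ∑ f.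
      opaque
        ∑ : (A → C) → C
        ∑ f = sum (f ∘ element)

        ∑≡sum : ∀ f → ∑ f ≡ sum (f ∘ element)
        ∑≡sum f = ≡.refl

        ∑-cong : {f g : A → C} → (∀ x → f x ≈′ g x) → ∑ f ≈′ ∑ g
        ∑-cong f≈g = sum-cong-≋ (f≈g ∘ element)

        ∑-distrib : (f g : A → C) → ∑ (λ x → f x ∙ g x) ≈′ ∑ f ∙ ∑ g
        ∑-distrib f g = ∑-distrib-+ (f ∘ element) (g ∘ element)

        ∑-swap : (f : A → A → C) → ∑ (λ x → ∑ (f x)) ≈′ ∑ (λ y → ∑ (λ x → f x y))
        ∑-swap f = ∑-comm (λ i j → f (element i) (element j))

        ∑-const : ∀ c → ∑ (λ _ → c) ≈′ N ⊗ c
        ∑-const c = sum-replicate N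

        -- An injection of a finite setoid into itself permutes the indices. `f` has to respect
        -- equality because `φ (element i)` is only `_≈_` to an enumerated element.
        ∑-reindex : {f : A → C} → Congruent _≈_ _≈′_ f → {φ : A → A} → Injective _≈_ _≈_ φ →
                    ∑ (f ∘ φ) ≈′ ∑ f
        ∑-reindex {f} f-cong {φ} φ-inj = sym′ (trans′ (sum-permute (f ∘ element) (toPermutation φ φ-inj))
          (sum-cong-≋ λ i → f-cong (strictlyInverseˡ (φ (element i)))))

        ∑-single : {f : A → C} → Congruent _≈_ _≈′_ f → ∀ x → (∀ y → ¬ y ≈ x → f y ≈′ ε) → ∑ f ≈′ f x
        ∑-single f-cong x away = trans′
          (sum-single _ (index x) λ j j≢ → away (element j) λ eq → j≢
              (≡.trans (≡.sym (strictlyInverseʳ j)) (from-cong eq)))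
          (f-cong (strictlyInverseˡ x))

open Cardinality

module FiniteFieldOfChar2 {c ℓ₁ ℓ₂ : Level} (K : HeytingField c ℓ₁ ℓ₂) (n : ℕ) (0<n : 0 ℕ.< n)
  (fin : HasCardinality (CommutativeRing.setoid (commutativeRing K)) (2 ℕ.^ n)) where

  -- Arithmetic of a field with 2ⁿ elements.

  module Field where

    open CommutativeRing (commutativeRing K) public hiding (_-_; zero)
    open RingProperties ring using (+-cancelˡ; +-cancelʳ; -0#≈0#)
    open Exp commutativeSemiring public using (_^_; ^-congˡ; ^-congʳ; ^-homo-*; ^-assocʳ; ^-distrib-*)
    open Finite {S = setoid} fin public
    open SetoidReasoning setoid

    -- Otherwise all elements are equal, and the constant map from 2ⁿ > 1 indices to `Fin 1` would
    -- be injective.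
    1≉0 : 1# ≉ 0#
    1≉0 1≈0 = ℕ.<⇒≱ (ℕ.^-monoʳ-< 2 ℕ.≤-refl 0<n) (Fin.injective⇒≤ {f = λ _ → zero {0}} λ {i} {j} _ →
        ≡.trans (≡.sym (strictlyInverseʳ i)) (≡.trans (from-cong (trans (x≈0 _) (sym (x≈0 _))))
            (strictlyInverseʳ j)))
      where
      open Inverse fin
      x≈0 : ∀ x → x ≈ 0#
      x≈0 x = trans (sym (*-identityˡ x)) (trans (*-congʳ 1≈0) (zeroˡ x))

    -- The inverse is found by exhaustive search. Apartness serves to refute failure: an element
    -- without inverse is not apart from 0, hence equals 0 by tightness.
    inverse : ∀ {x} → x ≉ 0# → ∃[ y ] x * y ≈ 1#
    inverse {x} x≉0 with any? (λ y → x * y ≟ 1#) (λ y≈z → trans (*-congˡ (sym y≈z)))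
    ... | yes inv = inv
    ... | no ¬inv = contradiction (proj₁ (tight x 0#) x¬#0) x≉0
      where
      open HeytingField K using (tight; #⇒invertible; _#_)
      x¬#0 : ¬ (x # 0#)
      x¬#0 x#0 = let (y , _ , eq) = #⇒invertible x#0 in
        ¬inv (y , trans (*-congʳ (sym (trans (+-congˡ -0#≈0#) (+-identityʳ x)))) eq)

    *-cancelˡ : ∀ {x y z} → x ≉ 0# → x * y ≈ x * z → y ≈ z
    *-cancelˡ {x} {y} {z} x≉0 eq = let (x⁻¹ , inv) = inverse x≉0 in
      let cancel u = begin
            u             ≈⟨ *-identityˡ u ⟨
            1# * u        ≈⟨ *-congʳ (trans (*-comm x⁻¹ x) inv) ⟨
            x⁻¹ * x * u   ≈⟨ *-assoc x⁻¹ x u ⟩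
            x⁻¹ * (x * u) ∎
      in trans (cancel y) (trans (*-congˡ eq) (sym (cancel z)))

    x*y≈0⇒y≈0 : ∀ {x y} → x ≉ 0# → x * y ≈ 0# → y ≈ 0#
    x*y≈0⇒y≈0 x≉0 eq = *-cancelˡ x≉0 (trans eq (sym (zeroʳ _)))

    *-nonzero : ∀ {x y} → x ≉ 0# → y ≉ 0# → x * y ≉ 0#
    *-nonzero x≉0 y≉0 = y≉0 ∘ x*y≈0⇒y≈0 x≉0

    ^-nonzero : ∀ {x} m → x ≉ 0# → x ^ m ≉ 0#
    ^-nonzero zero    x≉0 = 1≉0
    ^-nonzero (suc m) x≉0 = *-nonzero x≉0 (^-nonzero m x≉0)

    -- Translation by 1 permutes the field, so comparing the sums of all
    -- elements gives 2ⁿ × 1 ≈ 0.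
    1+1≈0 : 1# + 1# ≈ 0#
    1+1≈0 with 1# + 1# ≟ 0#
    ... | yes eq = eq
    ... | no neq = contradiction (trans (sym (2^m×1 n)) 2^n×1≈0) (^-nonzero n neq)
      where
      open BigOp +-commutativeMonoid
      open SemiringMult semiring using (×1-homo-*) renaming (_×_ to _⊗_)
      2^n×1≈0 : (2 ℕ.^ n) ⊗ 1# ≈ 0#
      2^n×1≈0 = +-cancelˡ (∑ λ y → y) _ _ (begin
        (∑ λ y → y) + (2 ℕ.^ n) ⊗ 1#     ≈⟨ +-congˡ (∑-const 1#) ⟨
        (∑ λ y → y) + (∑ λ _ → 1#)       ≈⟨ ∑-distrib (λ y → y) (λ _ → 1#) ⟨
        (∑ λ y → y + 1#)                 ≈⟨ ∑-reindex (λ eq → eq) (λ eq → +-cancelʳ _ _ _ eq) ⟩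
        (∑ λ y → y)                      ≈⟨ +-identityʳ _ ⟨
        (∑ λ y → y) + 0#                 ∎)
      2^m×1 : ∀ m → (2 ℕ.^ m) ⊗ 1# ≈ (1# + 1#) ^ m
      2^m×1 zero    = +-identityʳ 1#
      2^m×1 (suc m) = trans (×1-homo-* 2 (2 ℕ.^ m)) (*-cong (+-congˡ (+-identityʳ 1#)) (2^m×1 m))

    x+x≈0 : ∀ x → x + x ≈ 0#
    x+x≈0 x = begin
      x + x             ≈⟨ +-cong (*-identityʳ x) (*-identityʳ x) ⟨
      x * 1# + x * 1#   ≈⟨ distribˡ x 1# 1# ⟨
      x * (1# + 1#)     ≈⟨ *-congˡ 1+1≈0 ⟩
      x * 0#            ≈⟨ zeroʳ x ⟩
      0#                ∎

    -- With coefficients in Bool = 𝔽₂ the solver decides identities valid in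
    -- characteristic 2.
    module Solver where
      private
        𝔽₂ : RawRing _ _
        𝔽₂ = CommutativeRing.rawRing Bool.xor-∧-commutativeRing

        R : AlmostCommutativeRing _ _
        R = fromCommutativeRing (commutativeRing K)

        ⟦_⟧₂ : Bool → Carrier
        ⟦ false ⟧₂ = 0#
        ⟦ true  ⟧₂ = 1#

        -1≈1 : 1# ≈ - 1#
        -1≈1 = +-cancelˡ 1# _ _ (trans 1+1≈0 (sym (-‿inverseʳ 1#)))

        morphism : 𝔽₂ -Raw-AlmostCommutative⟶ R
        morphism = record
          { ⟦_⟧    = ⟦_⟧₂
          ; +-homo = λ { false _ → sym (+-identityˡ _) ; true false → sym (+-identityʳ _) ; true true →
              sym 1+1≈0 }
          ; *-homo = λ { false _ → sym (zeroˡ _) ; true _ → sym (*-identityˡ _) }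
          ; -‿homo = λ { false → sym -0#≈0# ; true → -1≈1 }
          ; 0-homo = refl
          ; 1-homo = refl
          }

        coefficient≟ : B.WeaklyDecidable (Induced-equivalence morphism)
        coefficient≟ false false = just refl
        coefficient≟ true  true  = just refl
        coefficient≟ _     _     = nothing

      open RingSolver 𝔽₂ R morphism coefficient≟ public

    open Solver public using (solve; _:=_; _:+_; _:*_; _:^_; con)

    x+y≈0⇒x≈y : ∀ {x y} → x + y ≈ 0# → x ≈ y
    x+y≈0⇒x≈y {x} {y} eq = begin
      x           ≈⟨ solve 2 (λ x y → x := (x :+ y) :+ y) refl x y ⟩
      x + y + y   ≈⟨ +-congʳ eq ⟩
      0# + y      ≈⟨ +-identityˡ y ⟩
      y           ∎

    x≈y⇒x+y≈0 : ∀ {x y} → x ≈ y → x + y ≈ 0#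
    x≈y⇒x+y≈0 {x} {y} x≈y = trans (+-congʳ x≈y) (x+x≈0 y)

    -- In characteristic 2, x² + y² = (x + y)², and the field has no zero divisors.
    square-injective : ∀ {x y} → x * x ≈ y * y → x ≈ y
    square-injective {x} {y} eq with x + y ≟ 0#
    ... | yes x+y≈0 = x+y≈0⇒x≈y x+y≈0
    ... | no  x+y≉0 = contradiction
          (trans (solve 2 (λ x y → (x :+ y) :* (x :+ y) := x :* x :+ y :* y) refl x y) (x≈y⇒x+y≈0 eq))
          (*-nonzero x+y≉0 x+y≉0)

    -- Multiplication by x ≉ 0 permutes the units, so comparing their products
    -- gives 1 ≈ ∏ t; the missing factor x of x ^ 2ⁿ comes from y ≈ 0.
    fermat : ∀ x → x ^ (2 ℕ.^ n) ≈ x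
    fermat x with x ≟ 0#
    ... | yes x≈0 = trans (^-congˡ (2 ℕ.^ n) x≈0) (trans (0^ (ℕ.m^n>0 2 n)) (sym x≈0))
      where
      0^ : ∀ {m} → 0 ℕ.< m → 0# ^ m ≈ 0#
      0^ {suc m} _ = zeroˡ _
    ... | no x≉0 = begin
      x ^ (2 ℕ.^ n)            ≈⟨ ∏-const x ⟨
      ∏ (λ _ → x)              ≈⟨ ∏-cong x≈td ⟩
      ∏ (λ y → t y * d y)      ≈⟨ ∏-distrib t d ⟩
      ∏ t * ∏ d                ≈⟨ *-cong ∏t≈1 ∏d≈x ⟩
      1# * x                   ≈⟨ *-identityˡ x ⟩
      x                        ∎
      where
      open BigOp *-commutativeMonoid using ()
        renaming ( ∑ to ∏; ∑≡sum to ∏≡sum; ∑-const to ∏-const; ∑-cong to ∏-cong; ∑-distrib to ∏-distrib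
                 ; ∑-reindex to ∏-reindex; ∑-single to ∏-single)
      if0 : ∀ {y} → Carrier → Carrier → Dec (y ≈ 0#) → Carrier
      if0 a b (yes _) = a
      if0 a b (no  _) = b
      if0-cong : ∀ {y z a b a′ b′} → y ≈ z → a ≈ a′ → b ≈ b′ → (p : Dec (y ≈ 0#)) (q : Dec (z ≈ 0#)) →
          if0 a b p ≈ if0 a′ b′ q
      if0-cong y≈z a≈ b≈ (yes p) (yes q) = a≈
      if0-cong y≈z a≈ b≈ (yes p) (no ¬q) = contradiction (trans (sym y≈z) p) ¬q
      if0-cong y≈z a≈ b≈ (no ¬p) (yes q) = contradiction (trans y≈z q) ¬p
      if0-cong y≈z a≈ b≈ (no ¬p) (no ¬q) = b≈
      -- `h` is the identity with 0 replaced by 1, so that its product is the product of the units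
      -- and can be cancelled. `t` and `d` split the constant `x` into its factors away from 0 and
      -- at 0.
      h t d : Carrier → Carrier
      h y = if0 1# y (y ≟ 0#)
      t y = if0 1# x (y ≟ 0#)
      d y = if0 x 1# (y ≟ 0#)
      x≈td : ∀ y → x ≈ t y * d y
      x≈td y with y ≟ 0#
      ... | yes _ = sym (*-identityˡ x)
      ... | no  _ = sym (*-identityʳ x)
      ∏d≈x : ∏ d ≈ x
      ∏d≈x = trans (∏-single (λ {y} {z} y≈z → if0-cong y≈z refl refl (y ≟ 0#) (z ≟ 0#)) 0# away) at0
        where
        away : ∀ y → y ≉ 0# → d y ≈ 1#
        away y y≉0 with y ≟ 0#
        ... | yes y≈0 = contradiction y≈0 y≉0
        ... | no  _   = refl
        at0 : d 0# ≈ x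
        at0 with 0# ≟ 0#
        ... | yes _   = refl
        ... | no  0≉0 = contradiction refl 0≉0
      h-nonzero : ∀ y → h y ≉ 0#
      h-nonzero y with y ≟ 0#
      ... | yes _   = 1≉0
      ... | no  y≉0 = y≉0
      ∏h≉0 : ∏ h ≉ 0#
      ∏h≉0 = (sum-nonzero (h ∘ element) (h-nonzero ∘ element)) ∘ trans (reflexive (≡.sym (∏≡sum h)))
        where
        open import Algebra.Properties.Monoid.Sum *-monoid using (sum)
        sum-nonzero : ∀ {m} (f : Fin m → Carrier) → (∀ i → f i ≉ 0#) → sum f ≉ 0#
        sum-nonzero {zero}  f f≉0 = 1≉0
        sum-nonzero {suc m} f f≉0 = *-nonzero (f≉0 zero) (sum-nonzero (f ∘ suc) (f≉0 ∘ suc))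
      h-scale : ∀ y → h (x * y) ≈ h y * t y
      h-scale y with y ≟ 0# | x * y ≟ 0#
      ... | yes _   | yes _    = sym (*-identityʳ 1#)
      ... | yes y≈0 | no xy≉0  = contradiction (trans (*-congˡ y≈0) (zeroʳ x)) xy≉0
      ... | no y≉0  | yes xy≈0 = contradiction xy≈0 (*-nonzero x≉0 y≉0)
      ... | no _    | no _     = *-comm x y
      ∏t≈1 : ∏ t ≈ 1#
      ∏t≈1 = *-cancelˡ ∏h≉0 (begin
        ∏ h * ∏ t               ≈⟨ ∏-distrib h t ⟨
        ∏ (λ y → h y * t y)     ≈⟨ ∏-cong h-scale ⟨
        ∏ (λ y → h (x * y))
          ≈⟨ ∏-reindex (λ {y} {z} y≈z → if0-cong y≈z refl y≈z (y ≟ 0#) (z ≟ 0#)) (*-cancelˡ x≉0) ⟩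
        ∏ h                     ≈⟨ *-identityʳ _ ⟨
        ∏ h * 1#                ∎)

  open Field

  -- Counting solutions when w^e + w^(e+1) is two-to-one.

  module Counting where

    open BigOp ℕ.+-0-commutativeMonoid
    open ≡.≡-Reasoning

    Q : ℕ
    Q = 2 ℕ.^ n

    ∑-constℕ : ∀ c → ∑ (λ _ → c) ≡ Q ℕ.* c
    ∑-constℕ c = ≡.trans (∑-const c) (×≡* Q)
      where
      open import Algebra.Properties.Monoid.Mult ℕ.+-0-monoid renaming (_×_ to _⊗_)
      ×≡* : ∀ m → m ⊗ c ≡ m ℕ.* c
      ×≡* zero    = ≡.refl
      ×≡* (suc m) = ≡.cong (c ℕ.+_) (×≡* m)

    ∑-*ˡ : ∀ c (f : Carrier → ℕ) → ∑ (λ x → c ℕ.* f x) ≡ c ℕ.* ∑ f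
    ∑-*ˡ c f = ≡.trans (∑≡sum _) (≡.sym (≡.trans (≡.cong (c ℕ.*_) (∑≡sum f))
        (SemiringSum.*-distribˡ-sum ℕ.+-*-semiring c (f ∘ element))))

    ∑-*ʳ : ∀ (f : Carrier → ℕ) c → ∑ (λ x → f x ℕ.* c) ≡ ∑ f ℕ.* c
    ∑-*ʳ f c = ≡.trans (∑≡sum _) (≡.sym (≡.trans (≡.cong (ℕ._* c) (∑≡sum f))
        (SemiringSum.*-distribʳ-sum ℕ.+-*-semiring c (f ∘ element))))

    ι-respects : {p : Level} {P : Pred Carrier p} (P? : Decidable P) → P B.Respects _≈_ →
                 ∀ {x y} → x ≈ y → ι (P? x) ≡ ι (P? y)
    ι-respects P? resp x≈y = ι-cong (P? _) (P? _) (resp x≈y) (resp (sym x≈y))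

    ∑-unique : {p : Level} {P : Pred Carrier p} (P? : Decidable P) → P B.Respects _≈_ →
               ∀ x → P x → (∀ y → P y → y ≈ x) → ∑ (ι ∘ P?) ≡ 1
    ∑-unique P? resp x px unique =
      ≡.trans (∑-single (ι-respects P? resp) x λ y y≉x → ι-no (P? y) (y≉x ∘ unique y)) (ι-yes (P? x) px)

    ∑-ι≟ : ∀ x → ∑ (λ y → ι (y ≟ x)) ≡ 1
    ∑-ι≟ x = ∑-unique (_≟ x) (λ eq → trans (sym eq)) x refl (λ _ eq → eq)

    -- Inserts the sum of `ι (φ w ≟ x)` over `x`, which is 1, and swaps the two sums. Applied to
    -- `g`, it passes from parameters to elements of the image.
    ∑-pushforward : (φ : Carrier → Carrier) {f : Carrier → ℕ} → (∀ {x y} → x ≈ y → f x ≡ f y) →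
                    ∑ (f ∘ φ) ≡ ∑ (λ x → ∑ (λ w → ι (φ w ≟ x)) ℕ.* f x)
    ∑-pushforward φ {f} f-cong = begin
      ∑ (f ∘ φ)                                ≡⟨ ∑-cong (λ w → ≡.sym (at w)) ⟩
      ∑ (λ w → ∑ (λ x → ι (φ w ≟ x) ℕ.* f x))  ≡⟨ ∑-swap _ ⟩
      ∑ (λ x → ∑ (λ w → ι (φ w ≟ x) ℕ.* f x))  ≡⟨ ∑-cong (λ x → ∑-*ʳ _ (f x)) ⟩
      ∑ (λ x → ∑ (λ w → ι (φ w ≟ x)) ℕ.* f x)  ∎
      where
      at : ∀ w → ∑ (λ x → ι (φ w ≟ x) ℕ.* f x) ≡ f (φ w)
      at w = ≡.trans
        (∑-single (λ x≈y → ≡.cong₂ ℕ._*_ (ι-cong (_ ≟ _) (_ ≟ _) (λ eq → trans eq x≈y) (λ eq → trans eq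
            (sym x≈y))) (f-cong x≈y))
          (φ w) (λ x x≉ → ≡.cong (ℕ._* f x) (ι-no (φ w ≟ x) (x≉ ∘ sym))))
        (≡.trans (≡.cong (ℕ._* f (φ w)) (ι-yes (φ w ≟ φ w) refl)) (ℕ.*-identityˡ _))

    ∑³ : (Carrier → Carrier → Carrier → ℕ) → ℕ
    ∑³ f = ∑ λ x → ∑ λ y → ∑ λ z → f x y z

    ∑³-cong : ∀ {f g} → (∀ x y z → f x y z ≡ g x y z) → ∑³ f ≡ ∑³ g
    ∑³-cong f≡g = ∑-cong λ x → ∑-cong λ y → ∑-cong λ z → f≡g x y z

    ∑³-distrib : ∀ f g → ∑³ (λ x y z → f x y z ℕ.+ g x y z) ≡ ∑³ f ℕ.+ ∑³ g
    ∑³-distrib f g = ≡.trans (∑-cong λ x → ≡.trans (∑-cong λ y → ∑-distrib _ _) (∑-distrib _ _))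
        (∑-distrib _ _)

    ∑³-*ˡ : ∀ c f → ∑³ (λ x y z → c ℕ.* f x y z) ≡ c ℕ.* ∑³ f
    ∑³-*ˡ c f = ≡.trans (∑-cong λ x → ≡.trans (∑-cong λ y → ∑-*ˡ c _) (∑-*ˡ c _)) (∑-*ˡ c _)

    ∑∑³-swap : (f : Carrier → Carrier → Carrier → Carrier → ℕ) →
               ∑ (λ r → ∑³ (f r)) ≡ ∑³ (λ x y z → ∑ (λ r → f r x y z))
    ∑∑³-swap f = ≡.trans (∑-swap _) (∑-cong λ x → ≡.trans (∑-swap _) (∑-cong λ y → ∑-swap _))

    module Combination (v₁ v₂ : Carrier) (v₁≉0 : v₁ ≉ 0#) (v₂≉0 : v₂ ≉ 0#) (v₁≉v₂ : v₁ ≉ v₂) where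

      v₃ : Carrier
      v₃ = v₁ + v₂

      v₃≉0 : v₃ ≉ 0#
      v₃≉0 = v₁≉v₂ ∘ x+y≈0⇒x≈y

      comb : Carrier → Carrier → Carrier → Carrier
      comb x y z = v₁ * x + v₂ * y + v₃ * z

      comb-cong : ∀ {x x′ y y′ z z′} → x ≈ x′ → y ≈ y′ → z ≈ z′ → comb x y z ≈ comb x′ y′ z′
      comb-cong x≈ y≈ z≈ = +-cong (+-cong (*-congˡ x≈) (*-congˡ y≈)) (*-congˡ z≈)

      -- The three weights add up to 0, so when two arguments agree only the difference to the third
      -- survives. As each weight is nonzero, a vanishing `comb` then forces all three to agree.
      comb-xxz : ∀ x z → comb x x z ≈ v₃ * (x + z)
      comb-xxz = solve 4 (λ v₁ v₂ x z → v₁ :* x :+ v₂ :* x :+ (v₁ :+ v₂) :* z := (v₁ :+ v₂) :*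
          (x :+ z)) refl v₁ v₂

      comb-xyx : ∀ x y → comb x y x ≈ v₂ * (x + y)
      comb-xyx = solve 4 (λ v₁ v₂ x y → v₁ :* x :+ v₂ :* y :+ (v₁ :+ v₂) :* x := v₂ :* (x :+ y)) refl v₁ v₂

      comb-xyy : ∀ x y → comb x y y ≈ v₁ * (x + y)
      comb-xyy = solve 4 (λ v₁ v₂ x y → v₁ :* x :+ v₂ :* y :+ (v₁ :+ v₂) :* y := v₁ :* (x :+ y)) refl v₁ v₂

      comb-linear : ∀ s x y z x′ y′ z′ →
        comb (x + s * x′) (y + s * y′) (z + s * z′) ≈ comb x y z + s * comb x′ y′ z′
      comb-linear = solve 9 (λ v₁ v₂ s x y z x′ y′ z′ →
        v₁ :* (x :+ s :* x′) :+ v₂ :* (y :+ s :* y′) :+ (v₁ :+ v₂) :* (z :+ s :* z′) :=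
        (v₁ :* x :+ v₂ :* y :+ (v₁ :+ v₂) :* z) :+ s :*
            (v₁ :* x′ :+ v₂ :* y′ :+ (v₁ :+ v₂) :* z′)) refl v₁ v₂

      comb-* : ∀ s x y z → comb (s * x) (s * y) (s * z) ≈ s * comb x y z
      comb-* = solve 6 (λ v₁ v₂ s x y z →
        v₁ :* (s :* x) :+ v₂ :* (s :* y) :+ (v₁ :+ v₂) :* (s :* z) :=
        s :* (v₁ :* x :+ v₂ :* y :+ (v₁ :+ v₂) :* z)) refl v₁ v₂

      zeros : (Carrier → Carrier) → ℕ
      zeros f = ∑³ λ x y z → ι (comb (f x) (f y) (f z) ≟ 0#)

      -- On a finite field `f` is also onto, and `v₃` is invertible; so `x` and `y` can be chosen
      -- freely and determine `z`.
      zeros-injective : (f : Carrier → Carrier) → (∀ {x y} → x ≈ y → f x ≈ f y) →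
                        (∀ {x y} → f x ≈ f y → x ≈ y) → zeros f ≡ Q ℕ.* Q
      zeros-injective f f-cong f-inj = begin
        zeros f                 ≡⟨ ∑-cong (λ x → ∑-cong λ y → fibre x y) ⟩
        ∑ (λ _ → ∑ (λ _ → 1))   ≡⟨ ∑-cong (λ _ → ≡.trans (∑-constℕ 1) (ℕ.*-identityʳ Q)) ⟩
        ∑ (λ _ → Q)             ≡⟨ ∑-constℕ Q ⟩
        Q ℕ.* Q                 ∎
        where
        fibre : ∀ x y → ∑ (λ z → ι (comb (f x) (f y) (f z) ≟ 0#)) ≡ 1
        fibre x y =
          let (v₃⁻¹ , inv) = inverse v₃≉0
              s = v₁ * f x + v₂ * f y
              (z , fz≈) = injective⇒surjective f-inj (v₃⁻¹ * s)
              v₃fz≈s = trans (*-congˡ fz≈) (trans (sym (*-assoc _ _ _))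
                  (trans (*-congʳ inv) (*-identityˡ s)))
          in ∑-unique _ (λ eq → trans (comb-cong refl refl (f-cong (sym eq)))) z
               (x≈y⇒x+y≈0 (sym v₃fz≈s))
               (λ z′ eq → f-inj (*-cancelˡ v₃≉0 (trans (sym (x+y≈0⇒x≈y eq)) (sym v₃fz≈s))))

    module TwoToOne (e : ℕ)
      (^e-injective : ∀ {x y} → x ^ e ≈ y ^ e → x ≈ y)
      (^1+e-injective : ∀ {x y} → x ^ suc e ≈ y ^ suc e → x ≈ y) where

      g : Carrier → Carrier
      g w = w ^ e + w ^ suc e

      g-cong : ∀ {x y} → x ≈ y → g x ≈ g y
      g-cong x≈y = +-cong (^-congˡ e x≈y) (^-congˡ (suc e) x≈y)

      -- The exponents `e` and `suc e` differ by one, so scaling the argument leaves a single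
      -- relative factor `r` besides the unit `r ^ e`.
      g-scale : ∀ r w → g (r * w) ≈ r ^ e * (w ^ e + r * w ^ suc e)
      g-scale r w = trans (+-cong (^-distrib-* r w e) (^-distrib-* r w (suc e)))
        (solve 4 (λ r w R W → R :* W :+ (r :* R) :* (w :* W) := R :* (W :+ r :* (w :* W))) refl r w
            (r ^ e) (w ^ e))

      module _
        (partner : ∀ w → ∃[ w′ ] (w′ ≉ w × g w′ ≈ g w))
        (two-of-three : ∀ {x y z} → g x ≈ g y → g y ≈ g z → x ≈ y ⊎ y ≈ z ⊎ x ≈ z) where

        image? : Decidable (λ x → ∃[ w ] x ≈ g w)
        image? x = any? (λ w → x ≟ g w) (λ w≈w′ eq → trans eq (g-cong w≈w′))

        -- In a nonempty fibre `partner` supplies a second point and `two-of-three` excludes a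
        -- third.
        preimages : ∀ x → ∑ (λ w → ι (g w ≟ x)) ≡ 2 ℕ.* ι (image? x)
        preimages x with image? x
        ... | no none = ≡.trans (∑-cong λ w → ι-no (g w ≟ x) λ eq → none (w , sym eq))
                                (≡.trans (∑-constℕ 0) (ℕ.*-zeroʳ Q))
        ... | yes (w , x≈gw) = begin
          ∑ (λ u → ι (g u ≟ x))                              ≡⟨ ∑-cong split ⟩
          ∑ (λ u → ι (u ≟ w) ℕ.+ ι (u ≟ w′))                 ≡⟨ ∑-distrib _ _ ⟩
          ∑ (λ u → ι (u ≟ w)) ℕ.+ ∑ (λ u → ι (u ≟ w′))       ≡⟨ ≡.cong₂ ℕ._+_ (∑-ι≟ w) (∑-ι≟ w′) ⟩
          2                                                  ∎
          where
          w′ = proj₁ (partner w)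
          w′≉w = proj₁ (proj₂ (partner w))
          gw′≈gw = proj₂ (proj₂ (partner w))
          split : ∀ u → ι (g u ≟ x) ≡ ι (u ≟ w) ℕ.+ ι (u ≟ w′)
          split u with u ≟ w | u ≟ w′
          ... | yes u≈w | yes u≈w′ = contradiction (trans (sym u≈w′) u≈w) w′≉w
          ... | yes u≈w | no _     = ι-yes (g u ≟ x) (trans (g-cong u≈w) (sym x≈gw))
          ... | no _    | yes u≈w′ = ι-yes (g u ≟ x) (trans (g-cong u≈w′) (trans gw′≈gw (sym x≈gw)))
          ... | no u≉w  | no u≉w′  = ι-no (g u ≟ x) λ gu≈x →
            [ u≉w , [ w′≉w ∘ sym , u≉w′ ]′ ]′ (two-of-three (trans gu≈x x≈gw) (sym gw′≈gw))

        private
          D : Carrier → ℕ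
          D x = ι (image? x)

          weighted : (Carrier → ℕ) → ℕ
          weighted f = ∑ (λ x → D x ℕ.* f x)

          weighted-cong : ∀ {f h} → (∀ x → f x ≡ h x) → weighted f ≡ weighted h
          weighted-cong f≡h = ∑-cong λ x → ≡.cong (D x ℕ.*_) (f≡h x)

          weighted-2* : ∀ f → weighted (λ x → 2 ℕ.* f x) ≡ 2 ℕ.* weighted f
          weighted-2* f = ≡.trans (∑-cong λ x → x*2*y (D x) (f x)) (∑-*ˡ 2 _)
            where
            open +-*-Solver renaming (solve to solveℕ; _:=_ to _⊜_; _:*_ to _⊗_; con to #_)
            x*2*y : ∀ x y → x ℕ.* (2 ℕ.* y) ≡ 2 ℕ.* (x ℕ.* y)
            x*2*y = solveℕ 2 (λ x y → x ⊗ (# 2 ⊗ y) ⊜ # 2 ⊗ (x ⊗ y)) ≡.refl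

          -- Used once for each of the three coordinates, which produces the factor 8 = 2³.
          ∑∘g : {f : Carrier → ℕ} → (∀ {x y} → x ≈ y → f x ≡ f y) → ∑ (f ∘ g) ≡ 2 ℕ.* weighted f
          ∑∘g {f} f-cong = ≡.trans (∑-pushforward g f-cong) (≡.trans
            (∑-cong λ x → ≡.trans (≡.cong (ℕ._* f x) (preimages x)) (ℕ.*-assoc 2 (D x) (f x))) (∑-*ˡ 2 _))

        module _ (v₁ v₂ : Carrier) (v₁≉0 : v₁ ≉ 0#) (v₂≉0 : v₂ ≉ 0#) (v₁≉v₂ : v₁ ≉ v₂) where

          open Combination v₁ v₂ v₁≉0 v₂≉0 v₁≉v₂

          W : ℕ
          W = weighted λ x → weighted λ y → weighted λ z → ι (comb x y z ≟ 0#)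

          private
            A B : Carrier → Carrier → Carrier → Carrier
            A x y z = comb (x ^ e) (y ^ e) (z ^ e)
            B x y z = comb (x ^ suc e) (y ^ suc e) (z ^ suc e)

            A≈0∧x≈z⇒y≈x : ∀ {x y z} → A x y z ≈ 0# → x ≈ z → y ≈ x
            A≈0∧x≈z⇒y≈x A≈0 x≈z = ^e-injective (sym (x+y≈0⇒x≈y (x*y≈0⇒y≈0 v₂≉0
              (trans (sym (comb-xyx _ _)) (trans (comb-cong refl refl (^-congˡ e x≈z)) A≈0)))))

            -- If x ≉ z then w ↦ w ^ (e + 1) + d * w ^ e takes the same value at
            -- x, y and z for a suitable d, and rescaling by d turns it into g.
            A≈0∧B≈0⇒x≈z : ∀ {x y z} → A x y z ≈ 0# → B x y z ≈ 0# → x ≈ z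
            A≈0∧B≈0⇒x≈z {x} {y} {z} A≈0 B≈0 with x ≟ z
            ... | yes x≈z = x≈z
            ... | no  x≉z with inverse {x ^ e + z ^ e} (x≉z ∘ ^e-injective ∘ x+y≈0⇒x≈y)
            ... | s⁻¹ , inv = conclude (d ≟ 0#)
              where
              -- The slope of the line through (x^e, x^(e+1)) and (z^e, z^(e+1)); it is not
              -- vertical, since x^e and z^e differ.
              d = (x ^ suc e + z ^ suc e) * s⁻¹
              val : Carrier → Carrier
              val w = w ^ suc e + d * w ^ e
              val-x≈z : val x ≈ val z
              val-x≈z = x+y≈0⇒x≈y (trans
                (solve 5 (λ X Z X′ Z′ i → (X′ :+ (X′ :+ Z′) :* i :* X) :+ (Z′ :+ (X′ :+ Z′) :* i :* Z)
                    := (X′ :+ Z′) :* ((X :+ Z) :* i :+ con true)) refl (x ^ e) (z ^ e) (x ^ suc e)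
                        (z ^ suc e) s⁻¹)
                (trans (*-congˡ (x≈y⇒x+y≈0 inv)) (zeroʳ _)))
              val-x≈y : val x ≈ val y
              val-x≈y = x+y≈0⇒x≈y (x*y≈0⇒y≈0 v₂≉0 (trans (sym (comb-xyx _ _)) (trans
                  (comb-cong refl refl val-x≈z)
                (trans (comb-linear d _ _ _ _ _ _) (trans (+-cong B≈0 (trans (*-congˡ A≈0) (zeroʳ d)))
                    (+-identityʳ 0#))))))
              conclude : Dec (d ≈ 0#) → x ≈ z
              -- A horizontal line cannot be rescaled by 1/d, but there `val` is the injective power
              -- w^(e+1).
              conclude (yes d≈0) = ^1+e-injective (trans (sym (val≈ x)) (trans val-x≈z (val≈ z)))
                where
                val≈ : ∀ w → val w ≈ w ^ suc e
                val≈ w = trans (+-congˡ (trans (*-congʳ d≈0) (zeroˡ _))) (+-identityʳ _)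
              conclude (no d≉0) = [ x≈y⇒x≈z ∘ cancel , [ y≈z⇒x≈z ∘ cancel , cancel ]′ ]′
                  (two-of-three (same val-x≈y) (same (trans (sym val-x≈y) val-x≈z)))
                where
                i = proj₁ (inverse d≉0)
                d*i≈1 = proj₂ (inverse d≉0)
                i≉0 : i ≉ 0#
                i≉0 i≈0 = 1≉0 (trans (sym d*i≈1) (trans (*-congˡ i≈0) (zeroʳ d)))
                cancel : ∀ {u w} → i * u ≈ i * w → u ≈ w
                cancel = *-cancelˡ i≉0
                g-val : ∀ w → g (i * w) ≈ i ^ suc e * val w
                g-val w = trans (g-scale i w) (trans (*-congˡ (+-congʳ (trans (sym (*-identityˡ _))
                    (*-congʳ (sym d*i≈1)))))
                  (solve 5 (λ i I d W W′ → I :* (d :* i :* W :+ i :* W′) := i :* I :* (W′ :+ d :* W)) refl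
                    i (i ^ e) d (w ^ e) (w ^ suc e)))
                same : ∀ {u w} → val u ≈ val w → g (i * u) ≈ g (i * w)
                same eq = trans (g-val _) (trans (*-congˡ eq) (sym (g-val _)))
                x≈y⇒x≈z : x ≈ y → x ≈ z
                x≈y⇒x≈z x≈y = ^e-injective (x+y≈0⇒x≈y (x*y≈0⇒y≈0 v₃≉0
                  (trans (sym (comb-xxz _ _)) (trans (comb-cong refl (^-congˡ e x≈y) refl) A≈0))))
                y≈z⇒x≈z : y ≈ z → x ≈ z
                y≈z⇒x≈z y≈z = ^e-injective (x+y≈0⇒x≈y (x*y≈0⇒y≈0 v₁≉0
                  (trans (sym (comb-xyy _ _)) (trans (comb-cong refl (^-congˡ e (sym y≈z)) refl) A≈0))))

            both? : ∀ x y z → Dec (A x y z ≈ 0# × B x y z ≈ 0#)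
            both? x y z = (A x y z ≟ 0#) ×-dec (B x y z ≟ 0#)

            common-zeros : ∑³ (λ x y z → ι (both? x y z)) ≡ Q
            common-zeros = begin
              ∑³ (λ x y z → ι (both? x y z))
                ≡⟨ ∑³-cong (λ x y z → ≡.trans (diagonal x y z) (ι-× (y ≟ x) (z ≟ x))) ⟩
              ∑³ (λ x y z → ι (y ≟ x) ℕ.* ι (z ≟ x))
                ≡⟨ ∑-cong (λ x → ∑-cong λ y → ≡.trans (∑-*ˡ (ι (y ≟ x)) (λ z → ι (z ≟ x)))
                    (≡.cong (ι (y ≟ x) ℕ.*_) (∑-ι≟ x))) ⟩
              ∑ (λ x → ∑ (λ y → ι (y ≟ x) ℕ.* 1))
                ≡⟨ ∑-cong (λ x → ≡.trans (∑-*ʳ _ 1) (≡.cong (ℕ._* 1) (∑-ι≟ x))) ⟩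
              ∑ (λ _ → 1)
                ≡⟨ ≡.trans (∑-constℕ 1) (ℕ.*-identityʳ Q) ⟩
              Q                                                    ∎
              where
              diagonal : ∀ x y z → ι (both? x y z) ≡ ι ((y ≟ x) ×-dec (z ≟ x))
              diagonal x y z = ι-cong (both? x y z) ((y ≟ x) ×-dec (z ≟ x))
                (λ (A≈0 , B≈0) → let x≈z = A≈0∧B≈0⇒x≈z A≈0 B≈0 in A≈0∧x≈z⇒y≈x A≈0 x≈z , sym x≈z)
                (λ (y≈x , z≈x) → on-diagonal e y≈x z≈x , on-diagonal (suc e) y≈x z≈x)
                where
                on-diagonal : ∀ m → y ≈ x → z ≈ x → comb (x ^ m) (y ^ m) (z ^ m) ≈ 0#
                on-diagonal m y≈x z≈x = trans (comb-cong refl (^-congˡ m y≈x) (^-congˡ m z≈x))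
                  (trans (comb-xxz _ _) (trans (*-congˡ (x+x≈0 _)) (zeroʳ v₃)))

            -- The equations `A + r B = 0` form a pencil. `r = 0` gives `A`; the remaining member,
            -- `B = 0` at r = ∞, enters the double count separately.
            T : Carrier → ℕ
            T r = ∑³ λ x y z → ι (A x y z + r * B x y z ≟ 0#)

            comb-g : ∀ r x y z → comb (g (r * x)) (g (r * y)) (g (r * z)) ≈ r ^ e * (A x y z + r * B x y z)
            comb-g r x y z = trans (comb-cong (g-scale r x) (g-scale r y) (g-scale r z))
              (trans (comb-* (r ^ e) _ _ _) (*-congˡ (comb-linear r _ _ _ _ _ _)))

            G : Carrier → Carrier → Carrier → ℕ
            G x y z = ι (comb x y z ≟ 0#)

            G-cong : ∀ {x x′ y y′ z z′} → x ≈ x′ → y ≈ y′ → z ≈ z′ → G x y z ≡ G x′ y′ z′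
            G-cong x≈ y≈ z≈ = ι-cong (_ ≟ 0#) (_ ≟ 0#)
              (trans (sym (comb-cong x≈ y≈ z≈))) (trans (comb-cong x≈ y≈ z≈))

            -- Multiplying the equation by the unit `r ^ e` turns it into the one for `g` with all
            -- three variables scaled by `r`, and scaling permutes the field.
            T-nonzero : ∀ {r} → r ≉ 0# → T r ≡ zeros g
            T-nonzero {r} r≉0 = begin
              T r
                ≡⟨ ∑³-cong (λ x y z → ι-cong (_ ≟ 0#) (_ ≟ 0#)
                    (λ eq → trans (comb-g r x y z) (trans (*-congˡ eq) (zeroʳ _)))
                    (λ eq → x*y≈0⇒y≈0 (^-nonzero e r≉0) (trans (sym (comb-g r x y z)) eq))) ⟩
              ∑³ (λ x y z → G (g (r * x)) (g (r * y)) (g (r * z)))    ≡⟨ ∑-cong (λ x → ∑-cong λ y →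
                  ∑-reindex (λ eq → G-cong refl refl (g-cong eq)) (*-cancelˡ r≉0)) ⟩
              ∑³ (λ x y z → G (g (r * x)) (g (r * y)) (g z))          ≡⟨ ∑-cong (λ x →
                  ∑-reindex (λ eq → ∑-cong λ z → G-cong refl (g-cong eq) refl) (*-cancelˡ r≉0)) ⟩
              ∑³ (λ x y z → G (g (r * x)) (g y) (g z))
                ≡⟨ ∑-reindex (λ eq → ∑-cong λ y → ∑-cong λ z → G-cong (g-cong eq) refl refl)
                    (*-cancelˡ r≉0) ⟩
              zeros g                                                 ∎

            T-zero : ∀ {r} → r ≈ 0# → T r ≡ Q ℕ.* Q
            T-zero {r} r≈0 = ≡.trans
              (∑³-cong λ x y z → ι-cong (_ ≟ 0#) (_ ≟ 0#) (trans (sym (A+0B≈A x y z)))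
                  (trans (A+0B≈A x y z)))
              (zeros-injective (_^ e) (^-congˡ e) ^e-injective)
              where
              A+0B≈A : ∀ x y z → A x y z + r * B x y z ≈ A x y z
              A+0B≈A x y z = trans (+-congˡ (trans (*-congʳ r≈0) (zeroˡ _))) (+-identityʳ _)

            -- Every `r` contributes `zeros g` except `r = 0`, which contributes Q². Adding
            -- `zeros g` on the left instead of subtracting it on the right keeps the identity in ℕ.
            ∑T-by-r : ∑ T ℕ.+ zeros g ≡ Q ℕ.* zeros g ℕ.+ Q ℕ.* Q
            ∑T-by-r = begin
              ∑ T ℕ.+ zeros g
                ≡⟨ ≡.cong (∑ T ℕ.+_) (weigh (zeros g)) ⟨
              ∑ T ℕ.+ ∑ (λ r → ι (r ≟ 0#) ℕ.* zeros g)                         ≡⟨ ∑-distrib _ _ ⟨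
              ∑ (λ r → T r ℕ.+ ι (r ≟ 0#) ℕ.* zeros g)
                ≡⟨ ∑-cong (λ r → balance (r ≟ 0#)) ⟩
              ∑ (λ r → zeros g ℕ.+ ι (r ≟ 0#) ℕ.* (Q ℕ.* Q))                   ≡⟨ ∑-distrib _ _ ⟩
              ∑ (λ _ → zeros g) ℕ.+ ∑ (λ r → ι (r ≟ 0#) ℕ.* (Q ℕ.* Q))
                ≡⟨ ≡.cong₂ ℕ._+_ (∑-constℕ (zeros g)) (weigh (Q ℕ.* Q)) ⟩
              Q ℕ.* zeros g ℕ.+ Q ℕ.* Q                                        ∎
              where
              weigh : ∀ c → ∑ (λ r → ι (r ≟ 0#) ℕ.* c) ≡ c
              weigh c = ≡.trans (∑-*ʳ _ c) (≡.trans (≡.cong (ℕ._* c) (∑-ι≟ 0#)) (ℕ.*-identityˡ c))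
              balance : ∀ {r} (r≟0 : Dec (r ≈ 0#)) → T r ℕ.+ ι r≟0 ℕ.* zeros g ≡ zeros g ℕ.+ ι r≟0 ℕ.*
                  (Q ℕ.* Q)
              balance (yes r≈0) = ≡.trans (≡.cong₂ ℕ._+_ (T-zero r≈0) (ℕ.*-identityˡ (zeros g)))
                                (≡.trans (ℕ.+-comm (Q ℕ.* Q) (zeros g)) (≡.cong (zeros g ℕ.+_) (≡.sym
                                    (ℕ.*-identityˡ (Q ℕ.* Q)))))
              balance (no r≉0)  = ≡.cong (ℕ._+ 0) (T-nonzero r≉0)

            -- `ι b≟0` accounts for the member `b = 0` at r = ∞. Of these Q + 1 equations exactly
            -- one holds, except when `a` and `b` both vanish and all of them hold.
            count-scalars : ∀ a {b} (b≟0 : Dec (b ≈ 0#)) →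
                      ∑ (λ r → ι (a + r * b ≟ 0#)) ℕ.+ ι b≟0 ≡ 1 ℕ.+ Q ℕ.* ι ((a ≟ 0#) ×-dec b≟0)
            count-scalars a {b} (no b≉0) = ≡.trans (≡.cong (ℕ._+ 0) unique) (≡.cong suc (≡.sym (≡.trans
                    (≡.cong (Q ℕ.*_) (≡.trans (ι-× (a ≟ 0#) (no b≉0)) (ℕ.*-zeroʳ (ι (a ≟ 0#)))))
                        (ℕ.*-zeroʳ Q))))
              where
              unique : ∑ (λ r → ι (a + r * b ≟ 0#)) ≡ 1
              unique =
                let (b⁻¹ , inv) = inverse b≉0
                    r*b≈a = trans (*-assoc a b⁻¹ b) (trans (*-congˡ (trans (*-comm b⁻¹ b) inv))
                        (*-identityʳ a))
                in ∑-unique _ (λ eq → trans (+-congˡ (*-congʳ (sym eq)))) (a * b⁻¹) (x≈y⇒x+y≈0 (sym r*b≈a))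
                    (λ r′ eq → *-cancelˡ b≉0 (trans (*-comm b r′)
                        (trans (trans (sym (x+y≈0⇒x≈y eq)) (sym r*b≈a)) (*-comm _ b))))
            count-scalars a {b} (yes b≈0) = begin
              ∑ (λ r → ι (a + r * b ≟ 0#)) ℕ.+ 1
                ≡⟨ ≡.cong (ℕ._+ 1) (∑-cong λ r → ι-cong (_ ≟ 0#) (a ≟ 0#) (trans (sym (a+rb≈a r)))
                    (trans (a+rb≈a r))) ⟩
              ∑ (λ _ → ι (a ≟ 0#)) ℕ.+ 1            ≡⟨ ≡.cong (ℕ._+ 1) (∑-constℕ _) ⟩
              Q ℕ.* ι (a ≟ 0#) ℕ.+ 1                ≡⟨ ℕ.+-comm _ 1 ⟩
              1 ℕ.+ Q ℕ.* ι (a ≟ 0#)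
                ≡⟨ ≡.cong (λ m → 1 ℕ.+ Q ℕ.* m) (≡.trans (ι-× (a ≟ 0#) (yes b≈0)) (ℕ.*-identityʳ _)) ⟨
              1 ℕ.+ Q ℕ.* ι ((a ≟ 0#) ×-dec yes b≈0) ∎
              where
              a+rb≈a : ∀ r → a + r * b ≈ a
              a+rb≈a r = trans (+-congˡ (trans (*-congˡ b≈0) (zeroʳ r))) (+-identityʳ a)

            -- The term added on the left is the number of zeros of `B`, the member of the pencil
            -- that `T` omits. On the right each of the Q³ points counts once, and the Q common
            -- zeros count Q times more.
            ∑T-by-point : ∑ T ℕ.+ Q ℕ.* Q ≡ Q ℕ.* (Q ℕ.* Q) ℕ.+ Q ℕ.* Q
            ∑T-by-point = begin
              ∑ T ℕ.+ Q ℕ.* Q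
                ≡⟨ ≡.cong₂ ℕ._+_ (≡.sym (∑∑³-swap _)) (zeros-injective (_^ suc e) (^-congˡ
                    (suc e)) ^1+e-injective) ⟨
              ∑³ (λ x y z → ∑ (λ r → ι (A x y z + r * B x y z ≟ 0#))) ℕ.+ ∑³ (λ x y z → ι (B x y z ≟ 0#))
                  ≡⟨ ∑³-distrib _ _ ⟨
              ∑³ (λ x y z → ∑ (λ r → ι (A x y z + r * B x y z ≟ 0#)) ℕ.+ ι (B x y z ≟ 0#))
                  ≡⟨ ∑³-cong (λ x y z → count-scalars (A x y z) (B x y z ≟ 0#)) ⟩
              ∑³ (λ x y z → 1 ℕ.+ Q ℕ.* ι (both? x y z))                    ≡⟨ ∑³-distrib _ _ ⟩
              ∑³ (λ x y z → 1) ℕ.+ ∑³ (λ x y z → Q ℕ.* ι (both? x y z))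
                ≡⟨ ≡.cong₂ ℕ._+_ ∑³1 (≡.trans (∑³-*ˡ Q _) (≡.cong (Q ℕ.*_) common-zeros)) ⟩
              Q ℕ.* (Q ℕ.* Q) ℕ.+ Q ℕ.* Q                                   ∎
              where
              ∑³1 : ∑³ (λ _ _ _ → 1) ≡ Q ℕ.* (Q ℕ.* Q)
              ∑³1 = ≡.trans (∑-cong λ _ → ≡.trans (∑-cong λ _ → ≡.trans (∑-constℕ 1) (ℕ.*-identityʳ Q))
                  (∑-constℕ Q)) (∑-constℕ (Q ℕ.* Q))

            -- With M = `zeros g`, the two counts give Q³ + M = Q M + Q², that is, (Q - 1) Q² = (Q -
            -- 1) M, and Q > 1.
            zeros-g : zeros g ≡ Q ℕ.* Q
            zeros-g = cancel Q (ℕ.^-monoʳ-< 2 ℕ.≤-refl 0<n)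
                (≡.trans (≡.cong (ℕ._+ zeros g) (≡.sym (ℕ.+-cancelʳ-≡ _ _ _ ∑T-by-point))) ∑T-by-r)
              where
              -- Only one factor Q on each side is abstracted to `q`; after matching, `suc q` is the
              -- factor Q - 1 to be cancelled.
              cancel : ∀ q → 1 ℕ.< q → q ℕ.* (Q ℕ.* Q) ℕ.+ zeros g ≡ q ℕ.* zeros g ℕ.+ Q ℕ.* Q →
                  zeros g ≡ Q ℕ.* Q
              cancel (suc (suc q)) _ eq = ≡.sym (ℕ.*-cancelˡ-≡ _ _ (suc q) (ℕ.+-cancelʳ-≡
                  (Q ℕ.* Q ℕ.+ zeros g) _ _
                  (≡.trans (shuffle (suc q ℕ.* (Q ℕ.* Q)) (Q ℕ.* Q) (zeros g))
                      (≡.trans eq (≡.trans (ℕ.+-comm (zeros g ℕ.+ _) (Q ℕ.* Q))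
                          (shuffle′ (suc q ℕ.* zeros g) (Q ℕ.* Q) (zeros g)))))))
                where
                open +-*-Solver renaming (solve to solveℕ; _:=_ to _⊜_; _:+_ to _⊕_)
                shuffle : ∀ a b c → a ℕ.+ (b ℕ.+ c) ≡ b ℕ.+ a ℕ.+ c
                shuffle = solveℕ 3 (λ a b c → a ⊕ (b ⊕ c) ⊜ b ⊕ a ⊕ c) ≡.refl
                shuffle′ : ∀ a b c → b ℕ.+ (c ℕ.+ a) ≡ a ℕ.+ (b ℕ.+ c)
                shuffle′ = solveℕ 3 (λ a b c → b ⊕ (c ⊕ a) ⊜ a ⊕ (b ⊕ c)) ≡.refl
              cancel (suc zero) (ℕ.s≤s ()) _

            zeros-g-by-image : zeros g ≡ 8 ℕ.* W
            zeros-g-by-image = begin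
              zeros g
                ≡⟨ ∑-cong (λ x → ∑-cong λ y → ∑∘g (G-cong refl refl)) ⟩
              ∑ (λ x → ∑ (λ y → 2 ℕ.* weighted (G (g x) (g y))))
                ≡⟨ ∑-cong (λ x → ∑∘g (λ eq → ≡.cong (2 ℕ.*_) (weighted-cong λ z → G-cong refl eq refl))) ⟩
              ∑ (λ x → 2 ℕ.* weighted (λ y → 2 ℕ.* weighted (G (g x) y)))
                ≡⟨ ∑∘g (λ eq → ≡.cong (2 ℕ.*_) (weighted-cong λ y → ≡.cong (2 ℕ.*_) (weighted-cong λ z →
                    G-cong eq refl refl))) ⟩
              2 ℕ.* weighted (λ x → 2 ℕ.* weighted (λ y → 2 ℕ.* weighted (G x y)))
                ≡⟨ ≡.cong (2 ℕ.*_) (weighted-cong λ x → ≡.cong (2 ℕ.*_) (weighted-2* _)) ⟩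
              2 ℕ.* weighted (λ x → 2 ℕ.* (2 ℕ.* weighted (λ y → weighted (G x y))))
                ≡⟨ ≡.cong (2 ℕ.*_) (≡.trans (weighted-2* _) (≡.cong (2 ℕ.*_) (weighted-2* _))) ⟩
              2 ℕ.* (2 ℕ.* (2 ℕ.* W))
                ≡⟨ ≡.trans (≡.cong (2 ℕ.*_) (≡.sym (ℕ.*-assoc 2 2 W))) (≡.sym (ℕ.*-assoc 2 4 W)) ⟩
              8 ℕ.* W ∎

            8W≡Q²⇒W : 8 ℕ.* W ≡ Q ℕ.* Q → W ≡ 2 ℕ.^ (2 ℕ.* n ∸ 3)
            8W≡Q²⇒W eq = solve-for n 0<n eq
              where
              solve-for : ∀ m → 0 ℕ.< m → 8 ℕ.* W ≡ 2 ℕ.^ m ℕ.* 2 ℕ.^ m → W ≡ 2 ℕ.^ (2 ℕ.* m ∸ 3)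
              -- For n = 1 there are no such v₁ and v₂: the equation reads 8 W ≡ 4.
              solve-for (suc zero) _ eq = contradiction (divides W (≡.trans (≡.sym eq) (ℕ.*-comm 8 W)))
                  (toWitnessFalse {a? = 8 ∣? 4} _)
              solve-for m@(suc (suc l)) _ eq = ℕ.*-cancelˡ-≡ _ _ 8 (begin
                8 ℕ.* W                               ≡⟨ eq ⟩
                2 ℕ.^ m ℕ.* 2 ℕ.^ m                   ≡⟨ ℕ.^-distribˡ-+-* 2 m m ⟨
                2 ℕ.^ (m ℕ.+ m)                       ≡⟨ ≡.cong (λ k → 2 ℕ.^ (m ℕ.+ k)) (ℕ.+-identityʳ m) ⟨
                2 ℕ.^ (2 ℕ.* m)                       ≡⟨ ≡.cong (2 ℕ.^_) (ℕ.m+[n∸m]≡n {3} 3≤2m) ⟨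
                2 ℕ.^ (3 ℕ.+ (2 ℕ.* m ∸ 3))           ≡⟨ ℕ.^-distribˡ-+-* 2 3 (2 ℕ.* m ∸ 3) ⟩
                8 ℕ.* 2 ℕ.^ (2 ℕ.* m ∸ 3)             ∎)
                where
                3≤2m : 3 ℕ.≤ 2 ℕ.* m
                3≤2m = ℕ.≤-trans (ℕ.n≤1+n 3) (ℕ.*-monoʳ-≤ 2 {2} {m} (ℕ.s≤s (ℕ.s≤s ℕ.z≤n)))

          W≡2^[2n∸3] : W ≡ 2 ℕ.^ (2 ℕ.* n ∸ 3)
          W≡2^[2n∸3] = 8W≡Q²⇒W (≡.trans (≡.sym zeros-g-by-image) zeros-g)

        -- The Kasami set enters only through its equality with the image of `g`, which also makes
        -- membership decidable.
        countEquality : (k : ℕ) → (∀ {x} → Kasami.Δ K k x → ∃[ w ] x ≈ g w) →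
                        (∀ {x} → ∃[ w ] x ≈ g w → Kasami.Δ K k x) →
                        Kasami.CountEquality K k n
        countEquality k Δ⇒image image⇒Δ v₁ v₂ v₁≉0 v₂≉0 v₁≉v₂ =
          ≡.subst (HasCardinality _) count (card-subset fin³ solution? solution-respects)
          where
          open Kasami K k using (Δ; Solution)
          open Combination v₁ v₂ v₁≉0 v₂≉0 v₁≉v₂ using (comb; comb-cong)

          Δ? : Decidable Δ
          Δ? x = map′ image⇒Δ Δ⇒image (image? x)

          solution? : Decidable (Solution v₁ v₂)
          solution? (x , y , z) = (Δ? x ×-dec Δ? y ×-dec Δ? z) ×-dec comb x y z ≟ 0#

          solution-respects : Solution v₁ v₂ B.Respects
              (λ (x , y , z) (x′ , y′ , z′) → x ≈ x′ × y ≈ y′ × z ≈ z′)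
          solution-respects (x≈ , y≈ , z≈) (((b₁ , x∈) , (b₂ , y∈) , (b₃ , z∈)) , eq) =
            ((b₁ , trans (sym x≈) x∈) , (b₂ , trans (sym y≈) y∈) , (b₃ , trans (sym z≈) z∈)) ,
            trans (sym (comb-cong x≈ y≈ z≈)) eq

          fin² : HasCardinality (×-setoid setoid setoid) (Q ℕ.* Q)
          fin² = card-× fin fin

          fin³ : HasCardinality (×-setoid setoid (×-setoid setoid setoid)) (Q ℕ.* (Q ℕ.* Q))
          fin³ = card-× fin fin²

          ι-Δ : ∀ x → ι (Δ? x) ≡ D x
          ι-Δ x = ι-cong (Δ? x) (image? x) Δ⇒image image⇒Δ

          ι-solution : ∀ x y z → ι (solution? (x , y , z)) ≡ D x ℕ.* (D y ℕ.* (D z ℕ.* ι (comb x y z ≟ 0#)))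
          ι-solution x y z = begin
            ι (solution? (x , y , z))
              ≡⟨ ι-× (Δ? x ×-dec Δ? y ×-dec Δ? z) (comb x y z ≟ 0#) ⟩
            ι (Δ? x ×-dec Δ? y ×-dec Δ? z) ℕ.* s
              ≡⟨ ≡.cong (ℕ._* s) (≡.trans (ι-× (Δ? x) (Δ? y ×-dec Δ? z))
                  (≡.cong (ι (Δ? x) ℕ.*_) (ι-× (Δ? y) (Δ? z)))) ⟩
            ι (Δ? x) ℕ.* (ι (Δ? y) ℕ.* ι (Δ? z)) ℕ.* s
              ≡⟨ ≡.cong (ℕ._* s) (≡.cong₂ ℕ._*_ (ι-Δ x) (≡.cong₂ ℕ._*_ (ι-Δ y) (ι-Δ z))) ⟩
            D x ℕ.* (D y ℕ.* D z) ℕ.* s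
              ≡⟨ ≡.trans (ℕ.*-assoc (D x) (D y ℕ.* D z) s) (≡.cong (D x ℕ.*_) (ℕ.*-assoc (D y) (D z) s)) ⟩
            D x ℕ.* (D y ℕ.* (D z ℕ.* s)) ∎
            where s = ι (comb x y z ≟ 0#)

          ∑-Fin³ : (f : Carrier × Carrier × Carrier → ℕ) → ∑ℕ (f ∘ Inverse.to fin³) ≡ ∑³
              (λ x y z → f (x , y , z))
          ∑-Fin³ f = begin
            ∑ℕ (f ∘ Inverse.to fin³)
              ≡⟨ ∑-remQuot Q (Q ℕ.* Q) (λ (i , j) → f (element i , Inverse.to fin² j)) ⟩
            ∑ℕ (λ i → ∑ℕ (λ j → f (element i , Inverse.to fin² j)))
              ≡⟨ ∑ℕ-cong {n = Q} (λ i → ∑-remQuot Q Q (λ (j , l) → f (element i , element j , element l))) ⟩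
            ∑ℕ (λ i → ∑ℕ (λ j → ∑ℕ (λ l → f (element i , element j , element l))))
              ≡⟨ ∑ℕ-cong {n = Q} (λ i → ∑ℕ-cong {n = Q} λ j → ∑≡sum (λ z → f (element i , element j , z))) ⟨
            ∑ℕ (λ i → ∑ℕ (λ j → ∑ (λ z → f (element i , element j , z))))
              ≡⟨ ∑ℕ-cong {n = Q} (λ i → ∑≡sum (λ y → ∑ (λ z → f (element i , y , z)))) ⟨
            ∑ℕ (λ i → ∑ (λ y → ∑ (λ z → f (element i , y , z))))
              ≡⟨ ∑≡sum (λ x → ∑ (λ y → ∑ (λ z → f (x , y , z)))) ⟨
            ∑³ (λ x y z → f (x , y , z)) ∎

          count : ∑ℕ (ι ∘ solution? ∘ Inverse.to fin³) ≡ 2 ℕ.^ (2 ℕ.* n ∸ 3)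
          count = begin
            ∑ℕ (ι ∘ solution? ∘ Inverse.to fin³)
              ≡⟨ ∑-Fin³ (ι ∘ solution?) ⟩
            ∑³ (λ x y z → ι (solution? (x , y , z)))
              ≡⟨ ∑³-cong ι-solution ⟩
            ∑³ (λ x y z → D x ℕ.* (D y ℕ.* (D z ℕ.* ι (comb x y z ≟ 0#))))
              ≡⟨ ∑-cong (λ x → ≡.trans (∑-cong λ y → ∑-*ˡ (D x) _)
                   (≡.trans (∑-*ˡ (D x) _) (≡.cong (D x ℕ.*_) (∑-cong λ y → ∑-*ˡ (D y) _)))) ⟩
            W v₁ v₂ v₁≉0 v₂≉0 v₁≉v₂
              ≡⟨ W≡2^[2n∸3] v₁ v₂ v₁≉0 v₂≉0 v₁≉v₂ ⟩
            2 ℕ.^ (2 ℕ.* n ∸ 3) ∎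

  -- Iterated Frobenius maps and the dependence of `Δ` on `k`.

  module Frobenius where

    open SetoidReasoning setoid

    φ : ℕ → Carrier → Carrier
    φ m x = x ^ (2 ℕ.^ m)

    φ-cong : ∀ m {x y} → x ≈ y → φ m x ≈ φ m y
    φ-cong m = ^-congˡ (2 ℕ.^ m)

    φ-∘ : ∀ l m x → φ m (φ l x) ≈ φ (l ℕ.+ m) x
    φ-∘ l m x = trans (^-assocʳ x (2 ℕ.^ l) (2 ℕ.^ m)) (^-congʳ x (≡.sym (ℕ.^-distribˡ-+-* 2 l m)))

    φ-comm : ∀ l m x → φ m (φ l x) ≈ φ l (φ m x)
    φ-comm l m x = trans (φ-∘ l m x) (trans (^-congʳ x (≡.cong (2 ℕ.^_) (ℕ.+-comm l m))) (sym (φ-∘ m l x)))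

    φ-suc : ∀ m x → φ (suc m) x ≈ φ m (x * x)
    φ-suc m x = trans (sym (φ-∘ 1 m x)) (φ-cong m (solve 1 (λ x → x :^ 2 := x :* x) refl x))

    φ-* : ∀ m x y → φ m (x * y) ≈ φ m x * φ m y
    φ-* m x y = ^-distrib-* x y (2 ℕ.^ m)

    φ-+ : ∀ m x y → φ m (x + y) ≈ φ m x + φ m y
    φ-+ zero    x y = trans (*-identityʳ _) (+-cong (sym (*-identityʳ x)) (sym (*-identityʳ y)))
    φ-+ (suc m) x y = begin
      φ (suc m) (x + y)             ≈⟨ φ-suc m (x + y) ⟩
      φ m ((x + y) * (x + y))
        ≈⟨ φ-cong m (solve 2 (λ x y → (x :+ y) :* (x :+ y) := x :* x :+ y :* y) refl x y) ⟩
      φ m (x * x + y * y)           ≈⟨ φ-+ m (x * x) (y * y) ⟩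
      φ m (x * x) + φ m (y * y)     ≈⟨ +-cong (φ-suc m x) (φ-suc m y) ⟨
      φ (suc m) x + φ (suc m) y     ∎

    φ-1 : ∀ m → φ m 1# ≈ 1#
    φ-1 zero    = *-identityʳ 1#
    φ-1 (suc m) = trans (φ-suc m 1#) (trans (φ-cong m (*-identityʳ 1#)) (φ-1 m))

    φ-injective : ∀ m {x y} → φ m x ≈ φ m y → x ≈ y
    φ-injective zero    eq = trans (sym (*-identityʳ _)) (trans eq (*-identityʳ _))
    φ-injective (suc m) eq = square-injective
        (φ-injective m (trans (sym (φ-suc m _)) (trans eq (φ-suc m _))))

    φ-fixed : ∀ m {x} → φ m x ≈ x → ∀ q → φ (q ℕ.* m) x ≈ x
    φ-fixed m     fixed zero    = *-identityʳ _
    φ-fixed m {x} fixed (suc q) = trans (sym (φ-∘ m (q ℕ.* m) x))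
        (trans (φ-cong (q ℕ.* m) fixed) (φ-fixed m fixed q))

    φ-period : ∀ q l x → φ (l ℕ.+ q ℕ.* n) x ≈ φ l x
    φ-period q l x = trans (sym (φ-∘ l (q ℕ.* n) x)) (φ-fixed n (fermat (φ l x)) q)

    φ-mod : ∀ l m → + l ≡ + m [mod n ] → ∀ x → φ l x ≈ φ m x
    φ-mod l m (divides q eq) x = [ m≥l , l≥m ]′ (ℕ.≤-total l m)
      where
      distance : ℤ.∣ l ℤ.⊖ m ∣ ≡ q ℕ.* n
      distance = ≡.trans (≡.cong ℤ.∣_∣ (≡.sym (ℤ.m-n≡m⊖n l m))) eq
      m≥l : l ℕ.≤ m → φ l x ≈ φ m x
      m≥l l≤m = sym (trans (^-congʳ x (≡.cong (2 ℕ.^_) (≡.trans (≡.sym (ℕ.m+[n∸m]≡n l≤m))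
        (≡.cong (l ℕ.+_) (≡.trans (≡.sym (ℤ.∣⊖∣-≤ l≤m)) distance))))) (φ-period q l x))
      l≥m : m ℕ.≤ l → φ l x ≈ φ m x
      l≥m m≤l = trans (^-congʳ x (≡.cong (2 ℕ.^_) (≡.trans (≡.sym (ℕ.m+[n∸m]≡n m≤l))
        (≡.cong (m ℕ.+_) (≡.trans (≡.sym (≡.trans (ℤ.∣m⊖n∣≡∣n⊖m∣ l m) (ℤ.∣⊖∣-≤ m≤l))) distance)))))
            (φ-period q m x)

    -- `x` is fixed by `φ k` and, by `fermat`, by `φ n`; Bézout then makes it fixed by `φ 1`, which
    -- is squaring.
    φ-coprime-fixed : ∀ {k} → gcd k n ≡ 1 → ∀ {x} → φ k x ≈ x → x * x ≈ x
    φ-coprime-fixed {k} coprime {x} fixed = trans (solve 1 (λ x → x :* x := x :^ 2) refl x)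
      (from-identity (Bézout.identity (≡.subst (GCD.GCD k n) coprime (gcd-GCD k n))))
      where
      φ-suc-multiple : ∀ q m → φ m x ≈ x → φ (1 ℕ.+ q ℕ.* m) x ≈ φ 1 x
      φ-suc-multiple q m fixed = trans (sym (trans (φ-comm (q ℕ.* m) 1 x) (φ-∘ 1 (q ℕ.* m) x)))
          (φ-cong 1 (φ-fixed m fixed q))
      from-identity : Bézout.Identity 1 k n → φ 1 x ≈ x
      from-identity (Bézout.+- p q eq) = trans (sym (φ-suc-multiple q n (fermat x)))
        (trans (^-congʳ x (≡.cong (2 ℕ.^_) eq)) (φ-fixed k fixed p))
      from-identity (Bézout.-+ p q eq) = trans (sym (φ-suc-multiple p k fixed))
        (trans (^-congʳ x (≡.cong (2 ℕ.^_) eq)) (φ-fixed n (fermat x) q))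

    module _ (k : ℕ) where
      open Kasami K k using (F; δ)

      exponent : ℕ
      exponent = 4 ℕ.^ k ∸ 2 ℕ.^ k ℕ.+ 1

      F-cong : ∀ {x y} → x ≈ y → F x ≈ F y
      F-cong = ^-congˡ exponent

      δ-cong : ∀ {x y} → x ≈ y → δ x ≈ δ y
      δ-cong x≈y = +-congʳ (+-cong (F-cong x≈y) (F-cong (+-congʳ x≈y)))

      F-φ : ∀ m x → F (φ m x) ≈ φ m (F x)
      F-φ m x = trans (^-assocʳ x (2 ℕ.^ m) exponent)
          (trans (^-congʳ x (ℕ.*-comm (2 ℕ.^ m) exponent)) (sym (^-assocʳ x exponent (2 ℕ.^ m))))

      φ-δ : ∀ m b → φ m (δ b) ≈ φ m (F b) + φ m (F (b + 1#)) + 1#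
      φ-δ m b = trans (φ-+ m _ 1#) (+-cong (φ-+ m _ _) (φ-1 m))

      δ-φ : ∀ m b → δ (φ m b) ≈ φ m (δ b)
      δ-φ m b = trans (+-congʳ (+-cong (F-φ m b)
          (trans (F-cong (trans (+-congˡ (sym (φ-1 m))) (sym (φ-+ m b 1#)))) (F-φ m (b + 1#)))))
                      (sym (φ-δ m b))

      F-zero : ∀ {x} → x ≈ 0# → F x ≈ 0#
      F-zero {x} x≈0 = trans (F-cong x≈0) (trans (^-congʳ 0# (ℕ.+-comm (4 ℕ.^ k ∸ 2 ℕ.^ k) 1)) (zeroˡ _))

      -- Adding 2ᵏ to the exponent 4ᵏ - 2ᵏ + 1 gives 4ᵏ + 1. Clearing the denominator in this way
      -- shows that `F` depends on `k` only through the map `φ k`.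
      F-characterisation : ∀ x → F x * φ k x ≈ φ k (φ k x) * x
      F-characterisation x = begin
        F x * φ k x                                  ≈⟨ ^-homo-* x exponent (2 ℕ.^ k) ⟨
        x ^ (exponent ℕ.+ 2 ℕ.^ k)                   ≈⟨ ^-congʳ x exponent+2^k ⟩
        x ^ (2 ℕ.^ k ℕ.* 2 ℕ.^ k ℕ.+ 1)              ≈⟨ ^-homo-* x (2 ℕ.^ k ℕ.* 2 ℕ.^ k) 1 ⟩
        x ^ (2 ℕ.^ k ℕ.* 2 ℕ.^ k) * x ^ 1
          ≈⟨ *-cong (sym (^-assocʳ x (2 ℕ.^ k) (2 ℕ.^ k))) (*-identityʳ x) ⟩
        φ k (φ k x) * x                              ∎
        where
        exponent+2^k : exponent ℕ.+ 2 ℕ.^ k ≡ 2 ℕ.^ k ℕ.* 2 ℕ.^ k ℕ.+ 1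
        exponent+2^k = ≡.trans (≡.trans (ℕ.+-assoc (4 ℕ.^ k ∸ 2 ℕ.^ k) 1 (2 ℕ.^ k))
            (≡.trans (≡.cong (4 ℕ.^ k ∸ 2 ℕ.^ k ℕ.+_) (ℕ.+-comm 1 (2 ℕ.^ k)))
                (≡.sym (ℕ.+-assoc (4 ℕ.^ k ∸ 2 ℕ.^ k) (2 ℕ.^ k) 1))))
          (≡.cong (ℕ._+ 1) (≡.trans (ℕ.m∸n+n≡m (ℕ.^-monoˡ-≤ k {2} {4} (ℕ.s≤s (ℕ.s≤s ℕ.z≤n))))
              (≡.trans (ℕ.^-*-assoc 2 2 k)
            (≡.trans (≡.cong (λ m → 2 ℕ.^ (k ℕ.+ m)) (ℕ.+-identityʳ k)) (ℕ.^-distribˡ-+-* 2 k k)))))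

    module _ (k j : ℕ) where

      private
        module Fk = Kasami K k
        module Fj = Kasami K j

      -- At `x ≈ 0` both sides of the equation vanish whatever `y` is, hence the separate assumption
      -- there.
      F-from-characterisation : ∀ {x y} → (x ≈ 0# → y ≈ 0#) → y * φ j x ≈ φ j (φ j x) * x → y ≈ Fj.F x
      F-from-characterisation {x} {y} at-zero eq with x ≟ 0#
      ... | yes x≈0 = trans (at-zero x≈0) (sym (F-zero j x≈0))
      ... | no  x≉0 = *-cancelˡ (^-nonzero (2 ℕ.^ j) x≉0)
          (trans (*-comm _ y) (trans eq (trans (sym (F-characterisation j x)) (*-comm _ _))))

      δ-congruent⁺ : + k ≡ + j [mod n ] → ∀ b → Fk.δ b ≈ Fj.δ b
      δ-congruent⁺ k≡j b = +-congʳ (+-cong (F≈ b) (F≈ (b + 1#)))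
        where
        φ≈ : ∀ x → φ k x ≈ φ j x
        φ≈ = φ-mod k j k≡j
        F≈ : ∀ x → Fk.F x ≈ Fj.F x
        F≈ x = F-from-characterisation (F-zero k) (trans (*-congˡ (sym (φ≈ x)))
          (trans (F-characterisation k x) (*-congʳ (trans (φ≈ _) (φ-cong j (φ≈ x))))))

      -- In exponents: with k = -j, 4ʲ (4ᵏ - 2ᵏ + 1) = 1 - 2ʲ + 4ʲ. As `φ j` inverts `φ k`, applying
      -- it twice to the characterisation of `F` for `k` yields the one for `j`.
      δ-congruent⁻ : + (k ℕ.+ j) ≡ + 0 [mod n ] → ∀ b → φ j (φ j (Fk.δ b)) ≈ Fj.δ b
      δ-congruent⁻ k+j≡0 b = trans (φ-cong j (φ-δ k j b))
          (trans (φ-+ j _ 1#) (+-cong (trans (φ-+ j _ _) (+-cong (F≈ b) (F≈ (b + 1#)))) (φ-1 j)))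
        where
        φφ≈id : ∀ x → φ j (φ k x) ≈ x
        φφ≈id x = trans (φ-∘ k j x) (trans (φ-mod (k ℕ.+ j) 0 k+j≡0 x) (*-identityʳ x))
        F≈ : ∀ x → φ j (φ j (Fk.F x)) ≈ Fj.F x
        F≈ x = F-from-characterisation (λ x≈0 → trans (φ-cong j (φ-cong j (F-zero k x≈0))) (trans
            (φ-cong j (φ-0 j)) (φ-0 j))) (begin
          φ j (φ j (Fk.F x)) * φ j x                       ≈⟨ *-congˡ (φ-cong j (φφ≈id x)) ⟨
          φ j (φ j (Fk.F x)) * φ j (φ j (φ k x))           ≈⟨ trans (φ-cong j (φ-* j _ _)) (φ-* j _ _) ⟨
          φ j (φ j (Fk.F x * φ k x))                       ≈⟨ φ-cong j (φ-cong j (F-characterisation k x)) ⟩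
          φ j (φ j (φ k (φ k x) * x))                      ≈⟨ trans (φ-cong j (φ-* j _ _)) (φ-* j _ _) ⟩
          φ j (φ j (φ k (φ k x))) * φ j (φ j x)
            ≈⟨ *-congʳ (trans (φ-cong j (φφ≈id _)) (φφ≈id x)) ⟩
          x * φ j (φ j x)                                  ≈⟨ *-comm x _ ⟩
          φ j (φ j x) * x                                  ∎)
          where
          φ-0 : ∀ m → φ m 0# ≈ 0#
          φ-0 m = trans (φ-cong m (sym (x+x≈0 1#)))
              (trans (φ-+ m 1# 1#) (trans (+-cong (φ-1 m) (φ-1 m)) (x+x≈0 1#)))

      -- In the second case the twist by `φ j` applied twice is harmless: it commutes with `δ` and
      -- is a bijection of the field, so it moves into the argument without changing the image.
      Δ-congruent : + k ≡ + j [mod n ] ⊎ + (k ℕ.+ j) ≡ + 0 [mod n ] →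
                    ∀ {x} → (Fk.Δ x → Fj.Δ x) × (Fj.Δ x → Fk.Δ x)
      Δ-congruent (inj₁ k≡j)   = (λ (b , eq) → b , trans eq (δ-congruent⁺ k≡j b)) ,
          (λ (b , eq) → b , trans eq (sym (δ-congruent⁺ k≡j b)))
      Δ-congruent (inj₂ k+j≡0) = to , from
        where
        δ-twist : ∀ b → Fk.δ (φ j (φ j b)) ≈ Fj.δ b
        δ-twist b = trans (δ-φ k j (φ j b)) (trans (φ-cong j (δ-φ k j b)) (δ-congruent⁻ k+j≡0 b))
        from : ∀ {x} → Fj.Δ x → Fk.Δ x
        from (b , eq) = φ j (φ j b) , trans eq (sym (δ-twist b))
        to : ∀ {x} → Fk.Δ x → Fj.Δ x
        to (b , eq) = let (c , φφc≈b) = injective⇒surjective (φ-injective j ∘ φ-injective j) b in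
          c , trans eq (trans (δ-cong k (sym φφc≈b)) (δ-twist c))

  -- The two-to-one maps behind `Δ` for `k = 1` and `k = 2`.

  module KasamiImages where

    open RingProperties ring using (+-cancelˡ)
    open Frobenius
    open Counting using (module TwoToOne)
    open SetoidReasoning setoid

    y≈x+[x+y] : ∀ x y → y ≈ x + (x + y)
    y≈x+[x+y] = solve 2 (λ x y → y := x :+ (x :+ y)) refl

    x*x+x≈0⇒x≈0⊎x≈1 : ∀ {x} → x * x + x ≈ 0# → x ≈ 0# ⊎ x ≈ 1#
    x*x+x≈0⇒x≈0⊎x≈1 {x} eq with x ≟ 0#
    ... | yes x≈0 = inj₁ x≈0
    ... | no  x≉0 = inj₂ (x+y≈0⇒x≈y (x*y≈0⇒y≈0 x≉0
          (trans (solve 1 (λ x → x :* (x :+ con true) := x :* x :+ x) refl x) eq)))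

    power-zero : ∀ {x y} m → x ≈ 0# → x ^ suc m ≈ y ^ suc m → x ≈ y
    power-zero {x} {y} m x≈0 eq with y ≟ 0#
    ... | yes y≈0 = trans x≈0 (sym y≈0)
    ... | no  y≉0 = contradiction (trans (sym eq) (trans (^-congˡ (suc m) x≈0) (zeroˡ _)))
        (^-nonzero (suc m) y≉0)

    module Quadratic where

      open TwoToOne 1
        (λ eq → trans (sym (*-identityʳ _)) (trans eq (*-identityʳ _)))
        (λ eq → square-injective (trans (sym (*-congˡ (*-identityʳ _)))
            (trans eq (*-congˡ (*-identityʳ _)))))

      partner : ∀ w → ∃[ w′ ] (w′ ≉ w × g w′ ≈ g w)
      partner w = w + 1# , (λ eq → 1≉0 (trans (solve 1 (λ w → con true := (w :+ con true) :+ w) refl w)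
          (x≈y⇒x+y≈0 eq))) ,
        solve 1 (λ w → (w :+ con true) :^ 1 :+ (w :+ con true) :^ 2 := w :^ 1 :+ w :^ 2) refl w

      -- For e = 1 the map `g` is additive, w + w², with kernel {0, 1}.
      x+y≈0⊎x+y≈1 : ∀ {x y} → g x ≈ g y → x + y ≈ 0# ⊎ x + y ≈ 1#
      x+y≈0⊎x+y≈1 {x} {y} eq = x*x+x≈0⇒x≈0⊎x≈1 (trans
        (solve 2 (λ x y → (x :+ y) :* (x :+ y) :+ (x :+ y) := (x :^ 1 :+ x :^ 2) :+
            (y :^ 1 :+ y :^ 2)) refl x y)
        (x≈y⇒x+y≈0 eq))

      two-of-three : ∀ {x y z} → g x ≈ g y → g y ≈ g z → x ≈ y ⊎ y ≈ z ⊎ x ≈ z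
      two-of-three {x} {y} {z} gx≈gy gy≈gz with x+y≈0⊎x+y≈1 gx≈gy | x+y≈0⊎x+y≈1 gy≈gz
      ... | inj₁ x+y≈0 | _          = inj₁ (x+y≈0⇒x≈y x+y≈0)
      ... | inj₂ _     | inj₁ y+z≈0 = inj₂ (inj₁ (x+y≈0⇒x≈y y+z≈0))
      ... | inj₂ x+y≈1 | inj₂ y+z≈1 = inj₂ (inj₂ (x+y≈0⇒x≈y (trans
            (solve 3 (λ x y z → x :+ z := (x :+ y) :+ (y :+ z)) refl x y z)
                (trans (+-cong x+y≈1 y+z≈1) (x+x≈0 1#)))))

      -- For `k = 1` the exponent is 4 - 2 + 1 = 3, and the cubes cancel.
      δ≈g : ∀ b → Kasami.δ K 1 b ≈ g b
      δ≈g = solve 1 (λ b → b :^ 3 :+ (b :+ con true) :^ 3 :+ con true := b :^ 1 :+ b :^ 2) refl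

      countEquality-±1 : ∀ {k} → + k ≡ + 1 [mod n ] ⊎ + (k ℕ.+ 1) ≡ + 0 [mod n ] →
          Kasami.CountEquality K k n
      countEquality-±1 {k} k≡±1 = countEquality partner two-of-three k
        (λ x∈Δ → let (b , eq) = proj₁ (Δ-congruent k 1 k≡±1) x∈Δ in b , trans eq (δ≈g b))
        (λ (b , eq) → proj₂ (Δ-congruent k 1 k≡±1) (b , trans eq (sym (δ≈g b))))

    -- The hypothesis says that the field has no primitive cube root of unity.
    module Sextic (b*b+b≉1 : ∀ b → b * b + b ≉ 1#) where

      1+b+b*b≉0 : ∀ b → b * b + b + 1# ≉ 0#
      1+b+b*b≉0 b = b*b+b≉1 b ∘ x+y≈0⇒x≈y

      -- x³ + y³ = (x + y)(x² + xy + y²), and for y ≠ 0 the second factor is y² (b² + b + 1) with b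
      -- = x / y.
      ^3-injective : ∀ {x y} → x ^ 3 ≈ y ^ 3 → x ≈ y
      ^3-injective {x} {y} eq with y ≟ 0# | x + y ≟ 0#
      ... | yes y≈0 | _         = sym (power-zero 2 y≈0 (sym eq))
      ... | no  _   | yes x+y≈0 = x+y≈0⇒x≈y x+y≈0
      ... | no  y≉0 | no  x+y≉0 = contradiction (begin
          b * b + b + 1#
            ≈⟨ +-cong (+-congˡ (trans (sym (*-identityʳ b)) (*-congˡ (sym inv))))
                (trans (sym (*-identityʳ 1#)) (*-cong (sym inv) (sym inv))) ⟩
          b * b + b * p + p * p     ≈⟨ solve 3 (λ x y i → let b = x :* i ; p = y :* i in
                                         b :* b :+ b :* p :+ p :* p := (x :* x :+ x :* y :+ y :* y) :*
                                             (i :* i)) refl x y i ⟩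
          (x * x + x * y + y * y) * (i * i)  ≈⟨ *-congʳ factor≈0 ⟩
          0# * (i * i)              ≈⟨ zeroˡ _ ⟩
          0#                        ∎) (1+b+b*b≉0 b)
        where
        i = proj₁ (inverse y≉0)
        inv = proj₂ (inverse y≉0)
        b = x * i
        p = y * i
        factor≈0 : x * x + x * y + y * y ≈ 0#
        factor≈0 = x*y≈0⇒y≈0 x+y≉0 (trans
          (solve 2 (λ x y → (x :+ y) :* (x :* x :+ x :* y :+ y :* y) := x :^ 3 :+ y :^ 3) refl x y)
              (x≈y⇒x+y≈0 eq))

      ^6-injective : ∀ {x y} → x ^ 6 ≈ y ^ 6 → x ≈ y
      ^6-injective {x} {y} eq = ^3-injective (square-injective (trans (cube² x) (trans eq (sym (cube² y)))))
        where
        cube² : ∀ x → x ^ 3 * x ^ 3 ≈ x ^ 6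
        cube² = solve 1 (λ x → x :^ 3 :* x :^ 3 := x :^ 6) refl

      -- x⁴ + x³y + x²y² + xy³ + y⁴ = x²y² (q² + q + 1) for q = x/y + y/x.
      ^5-injective : ∀ {x y} → x ^ 5 ≈ y ^ 5 → x ≈ y
      ^5-injective {x} {y} eq with x ≟ 0# | y ≟ 0# | x + y ≟ 0#
      ... | yes x≈0 | _       | _         = power-zero 4 x≈0 eq
      ... | no  _   | yes y≈0 | _         = sym (power-zero 4 y≈0 (sym eq))
      ... | no  _   | no  _   | yes x+y≈0 = x+y≈0⇒x≈y x+y≈0
      ... | no  x≉0 | no  y≉0 | no  x+y≉0 = contradiction (begin
          q * q + q + 1#
            ≈⟨ +-cong (+-congˡ (trans (sym (*-identityʳ q)) (*-congˡ (sym inv))))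
                (trans (sym (*-identityʳ 1#)) (*-cong (sym inv) (sym inv))) ⟩
          q * q + q * p + p * p
            ≈⟨ solve 3 (λ x y i → let q = (x :* x :+ y :* y) :* i ; p = (x :* y) :* i in
                  q :* q :+ q :* p :+ p :* p :=
                  (x :^ 4 :+ x :^ 3 :* y :+ x :^ 2 :* y :^ 2 :+ x :* y :^ 3 :+ y :^ 4) :* (i :* i)) refl x y i ⟩
          factor * (i * i)          ≈⟨ *-congʳ factor≈0 ⟩
          0# * (i * i)              ≈⟨ zeroˡ _ ⟩
          0#                        ∎) (1+b+b*b≉0 q)
        where
        xy≉0 = *-nonzero x≉0 y≉0
        i = proj₁ (inverse xy≉0)
        inv = proj₂ (inverse xy≉0)
        q = (x * x + y * y) * i
        p = x * y * i
        factor = x ^ 4 + x ^ 3 * y + x ^ 2 * y ^ 2 + x * y ^ 3 + y ^ 4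
        factor≈0 : factor ≈ 0#
        factor≈0 = x*y≈0⇒y≈0 x+y≉0 (trans
          (solve 2 (λ x y → (x :+ y) :* (x :^ 4 :+ x :^ 3 :* y :+ x :^ 2 :* y :^ 2 :+ x :* y :^ 3 :+ y :^ 4) :=
            x :^ 5 :+ y :^ 5) refl x y)
          (x≈y⇒x+y≈0 eq))

      open TwoToOne 5 ^5-injective ^6-injective

      -- The additive subgroup of elements of trace 0.
      AS : Carrier → Set _
      AS x = ∃[ b ] x ≈ b * b + b

      AS-+ : ∀ {x y} → AS x → AS y → AS (x + y)
      AS-+ (a , x≈) (b , y≈) = a + b , trans (+-cong x≈ y≈)
        (solve 2 (λ a b → (a :* a :+ a) :+ (b :* b :+ b) := (a :+ b) :* (a :+ b) :+ (a :+ b)) refl a b)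

      v i : Carrier → Carrier
      v m = m * m + m
      i m = proj₁ (inverse (b*b+b≉1 m ∘ x+y≈0⇒x≈y))

      [v+1]i≈1 : ∀ m → (v m + 1#) * i m ≈ 1#
      [v+1]i≈1 m = proj₂ (inverse (b*b+b≉1 m ∘ x+y≈0⇒x≈y))

      -- The two points are s m and s (m + 1), so s⁵ factors out and the remaining factor is linear
      -- in `s`: for given `m` the step `s` is a rational function of `m`. The coefficients involve
      -- only m² + m because exchanging the points replaces `m` by m + 1.
      g-difference : ∀ s m → g (s * m) + g (s * m + s) ≈ s ^ 5 *
          (s * (v m * v m + 1#) + (v m * v m + v m + 1#))
      g-difference = solve 2 (λ s m → let v = m :* m :+ m ; w = s :* m in
        (w :^ 5 :+ w :^ 6) :+ ((w :+ s) :^ 5 :+ (w :+ s) :^ 6) :=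
        s :^ 5 :* (s :* (v :* v :+ con true) :+ (v :* v :+ v :+ con true))) refl

      -- With s = x + y, m = x / s and i = 1 / (v + 1), where v = m² + m, the equation
      -- g (s m) = g (s m + s) becomes s (v + 1)² = v² + v + 1, that is, s + 1 = i² + i.
      collision-sum : ∀ {x y} → g x ≈ g y → x ≉ y → AS (x + y + 1#)
      collision-sum {x} {y} gx≈gy x≉y = i m , (begin
        s + 1#                                      ≈⟨ +-cong s≈ 1≈ ⟩
        (V * V + V + 1#) * (I * I) + u * u          ≈⟨ solve 2 (λ V I → let u = (V :+ con true) :* I in
            (V :* V :+ V :+ con true) :* (I :* I) :+ u :* u := I :* I :+ I :* u) refl V I ⟩
        I * I + I * u
          ≈⟨ +-congˡ (trans (*-congˡ ([v+1]i≈1 m)) (*-identityʳ I)) ⟩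
        I * I + I                                   ∎)
        where
        s = x + y
        s≉0 : s ≉ 0#
        s≉0 = x≉y ∘ x+y≈0⇒x≈y
        m = x * proj₁ (inverse s≉0)
        V = v m
        I = i m
        u = (V + 1#) * I
        1≈ : 1# ≈ u * u
        1≈ = trans (sym (*-identityʳ 1#)) (*-cong (sym ([v+1]i≈1 m)) (sym ([v+1]i≈1 m)))
        sm≈x : s * m ≈ x
        sm≈x = trans (solve 3 (λ s x j → s :* (x :* j) := x :* (s :* j)) refl s x _)
                     (trans (*-congˡ (proj₂ (inverse s≉0))) (*-identityʳ x))
        sm+s≈y : s * m + s ≈ y
        sm+s≈y = trans (+-congʳ sm≈x) (sym (y≈x+[x+y] x y))
        s[v²+1]≈v²+v+1 : s * (V * V + 1#) ≈ V * V + V + 1#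
        s[v²+1]≈v²+v+1 = x+y≈0⇒x≈y (x*y≈0⇒y≈0 (^-nonzero 5 s≉0) (trans (sym (g-difference s m))
          (trans (+-cong (g-cong sm≈x) (g-cong sm+s≈y)) (x≈y⇒x+y≈0 gx≈gy))))
        s≈ : s ≈ (V * V + V + 1#) * (I * I)
        s≈ = begin
          s                              ≈⟨ trans (sym (*-identityʳ s)) (*-congˡ 1≈) ⟩
          s * (u * u)                    ≈⟨ solve 3 (λ s V I → let u = (V :+ con true) :* I in
                                              s :* (u :* u) := s :* (V :* V :+ con true) :*
                                                  (I :* I)) refl s V I ⟩
          s * (V * V + 1#) * (I * I)     ≈⟨ *-congʳ s[v²+1]≈v²+v+1 ⟩
          (V * V + V + 1#) * (I * I)     ∎

      -- For three distinct points the elements x + y + 1, y + z + 1 and x + z + 1 all lie in the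
      -- group `AS`, yet they add up to 1, which does not.
      two-of-three : ∀ {x y z} → g x ≈ g y → g y ≈ g z → x ≈ y ⊎ y ≈ z ⊎ x ≈ z
      two-of-three {x} {y} {z} gx≈gy gy≈gz with x ≟ y | y ≟ z | x ≟ z
      ... | yes x≈y | _       | _       = inj₁ x≈y
      ... | no  _   | yes y≈z | _       = inj₂ (inj₁ y≈z)
      ... | no  _   | no  _   | yes x≈z = inj₂ (inj₂ x≈z)
      ... | no  x≉y | no  y≉z | no  x≉z =
        let (b , eq) = AS-+ (AS-+ (collision-sum gx≈gy x≉y) (collision-sum gy≈gz y≉z))
                            (collision-sum (trans gx≈gy gy≈gz) x≉z)
        in contradiction (trans (sym eq) (solve 3 (λ x y z →
             ((x :+ y :+ con true) :+ (y :+ z :+ con true)) :+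
                 (x :+ z :+ con true) := con true) refl x y z)) (b*b+b≉1 b)

      -- The pairs {w, w + s} with g w ≈ g (w + s) are parametrised by m = w / s.
      opaque
        s : Carrier → Carrier
        s m = (v m * v m + v m + 1#) * (i m * i m)

        s-nonzero : ∀ m → s m ≉ 0#
        s-nonzero m = *-nonzero (1+b+b*b≉0 (v m)) (*-nonzero i≉0 i≉0)
          where
          i≉0 : i m ≉ 0#
          i≉0 i≈0 = 1≉0 (trans (sym ([v+1]i≈1 m)) (trans (*-congˡ i≈0) (zeroʳ _)))

        s[v²+1]≈v²+v+1 : ∀ m → s m * (v m * v m + 1#) ≈ v m * v m + v m + 1#
        s[v²+1]≈v²+v+1 m = normalise (v m) (i m) ([v+1]i≈1 m)
          where
          normalise : ∀ V I → (V + 1#) * I ≈ 1# → (V * V + V + 1#) * (I * I) * (V * V + 1#) ≈ V * V + V + 1#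
          normalise V I u≈1 = begin
            (V * V + V + 1#) * (I * I) * (V * V + 1#)
              ≈⟨ solve 2 (λ V I → let u = (V :+ con true) :* I in
                  (V :* V :+ V :+ con true) :* (I :* I) :* (V :* V :+ con true) :=
                  (V :* V :+ V :+ con true) :* (u :* u)) refl V I ⟩
            (V * V + V + 1#) * ((V + 1#) * I * ((V + 1#) * I))
              ≈⟨ *-congˡ (trans (*-cong u≈1 u≈1) (*-identityʳ 1#)) ⟩
            (V * V + V + 1#) * 1#                               ≈⟨ *-identityʳ (V * V + V + 1#) ⟩
            V * V + V + 1#                                      ∎

      g-pair : ∀ m → g (s m * m) ≈ g (s m * m + s m)
      g-pair m = x+y≈0⇒x≈y (trans (g-difference (s m) m)
        (trans (*-congˡ (x≈y⇒x+y≈0 (s[v²+1]≈v²+v+1 m))) (zeroʳ (s m ^ 5))))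

      w≉w+s : ∀ m w → w ≉ w + s m
      w≉w+s m w eq = s-nonzero m (trans (solve 2 (λ w s → s := w :+ (w :+ s)) refl w (s m)) (x≈y⇒x+y≈0 eq))

      -- If w = w′, then `g` agrees at w + s, w and w′ + s′, so two of these coincide. The steps are
      -- nonzero, which leaves s = s′, and m is w / s.
      parametrisation-injective : ∀ {m m′} → s m * m ≈ s m′ * m′ → m ≈ m′
      parametrisation-injective {m} {m′} eq =
          [ (λ w+s≈w → contradiction (sym w+s≈w) (w≉w+s m w))
          , [ (λ w≈w′+s′ → contradiction (trans (sym eq) w≈w′+s′) (w≉w+s m′ w′)) , same-s ]′ ]′
          (two-of-three {w + s m} {w} {w′ + s m′} (sym (g-pair m)) (trans (g-cong eq) (g-pair m′)))
        where
        w w′ : Carrier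
        w  = s m * m
        w′ = s m′ * m′
        same-s : w + s m ≈ w′ + s m′ → m ≈ m′
        same-s w+s≈w′+s′ = *-cancelˡ (s-nonzero m) (trans eq (*-congʳ (sym s≈s′)))
          where
          s≈s′ : s m ≈ s m′
          s≈s′ = +-cancelˡ w (s m) (s m′) (trans w+s≈w′+s′ (+-congʳ (sym eq)))

      -- Finding `m` with s(m) m = w directly would mean solving a polynomial equation; finiteness
      -- turns injectivity of the parametrisation into existence.
      partner : ∀ w → ∃[ w′ ] (w′ ≉ w × g w′ ≈ g w)
      partner w = let (m , sm≈w) = injective⇒surjective {f = λ m → s m * m} parametrisation-injective w in
        w + s m , w≉w+s m w ∘ sym , trans (g-cong (+-congʳ (sym sm≈w)))
            (trans (sym (g-pair m)) (g-cong sm≈w))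

      -- Selecting one element b of each pair {b, b + 1} makes b ↦ b² + b,
      -- shifted by 1 on the selected elements, injective and hence onto.
      AS-index-2 : ∀ x → AS x ⊎ AS (x + 1#)
      AS-index-2 x = let (b , eq) = injective⇒surjective {f = λ b → shifted (selected? b)}
                                              (shifted-injective (selected? _) (selected? _)) x
                     in conclude (selected? b) eq
        where
        Selected : Carrier → Set
        Selected b = index b Fin.< index (b + 1#)
        selected? : ∀ b → Dec (Selected b)
        selected? b = index b Fin.<? index (b + 1#)
        shifted : ∀ {b} → Dec (Selected b) → Carrier
        shifted {b} (yes _) = b * b + b + 1#
        shifted {b} (no  _) = b * b + b
        conclude : ∀ {b} (p : Dec (Selected b)) → shifted p ≈ x → AS x ⊎ AS (x + 1#)
        conclude {b} (yes _) eq = inj₂ (b , trans (+-congʳ (sym eq)) (solve 1 (λ y →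
            (y :+ con true) :+ con true := y) refl (b * b + b)))
        conclude {b} (no  _) eq = inj₁ (b , sym eq)
        index-cong : ∀ {b c} → b ≈ c → index b ≡ index c
        index-cong = Inverse.from-cong fin
        c≈b+1 : ∀ {b c} → b + c ≈ 1# → c ≈ b + 1#
        c≈b+1 {b} {c} eq = trans (y≈x+[x+y] b c) (+-congˡ eq)
        difference : ∀ b c → (b + c) * (b + c) + (b + c) ≈ (b * b + b) + (c * c + c)
        difference = solve 2 (λ b c → (b :+ c) :* (b :+ c) :+ (b :+ c) := (b :* b :+ b) :+
            (c :* c :+ c)) refl
        index-swap : ∀ {b c} → b + c ≈ 1# → index c ≡ index (b + 1#) × index (c + 1#) ≡ index b
        index-swap {b} {c} eq = index-cong (c≈b+1 eq) , index-cong (sym (c≈b+1 (trans (+-comm c b) eq)))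
        shifted-injective : ∀ {b c} (p : Dec (Selected b)) (q : Dec (Selected c)) →
            shifted p ≈ shifted q → b ≈ c
        shifted-injective {b} {c} (yes p) (no _)  eq = contradiction (trans (difference b c)
          (trans (+-congˡ (sym eq)) (solve 1 (λ y → y :+ (y :+ con true) := con true) refl
              (b * b + b)))) (b*b+b≉1 (b + c))
        shifted-injective {b} {c} (no _)  (yes q) eq = contradiction (trans (difference b c)
          (trans (+-congʳ eq) (solve 1 (λ y → (y :+ con true) :+ y := con true) refl (c * c + c))))
              (b*b+b≉1 (b + c))
        shifted-injective {b} {c} (yes p) (yes q) eq = [ x+y≈0⇒x≈y , clash ]′
            (x*x+x≈0⇒x≈0⊎x≈1 (trans (difference b c)
          (trans (solve 2 (λ y z → y :+ z := (y :+ con true) :+ (z :+ con true)) refl (b * b + b)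
              (c * c + c)) (x≈y⇒x+y≈0 eq))))
          where
          clash : b + c ≈ 1# → b ≈ c
          clash b+c≈1 = let (e₁ , e₂) = index-swap b+c≈1 in
            contradiction (≡.subst₂ Fin._<_ e₁ e₂ q) (Fin.<-asym p)
        shifted-injective {b} {c} (no ¬p) (no ¬q) eq = [ x+y≈0⇒x≈y , clash ]′
            (x*x+x≈0⇒x≈0⊎x≈1 (trans (difference b c) (x≈y⇒x+y≈0 eq)))
          where
          clash : b + c ≈ 1# → b ≈ c
          clash b+c≈1 with Fin.<-cmp (index b) (index (b + 1#))
          ... | B.tri< p _ _ = contradiction p ¬p
          ... | B.tri> _ _ q = let (e₁ , e₂) = index-swap b+c≈1 in
              contradiction (≡.subst₂ Fin._<_ (≡.sym e₁) (≡.sym e₂) q) ¬q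
          ... | B.tri≈ _ e _ = contradiction (trans (solve 1 (λ b → con true := b :+
              (b :+ con true)) refl b) (x≈y⇒x+y≈0 (index-injective e))) 1≉0
            where
            index-injective : ∀ {x y} → index x ≡ index y → x ≈ y
            index-injective e = trans (sym (Inverse.strictlyInverseˡ fin _))
                (trans (Inverse.to-cong fin e) (Inverse.strictlyInverseˡ fin _))

      -- The exponent is 16 - 4 + 1 = 13. Since δ (b + 1) = δ b, it is a polynomial in b² + b;
      -- written in w = b² + b + 1 it becomes w⁵ + w⁶, the origin of e = 5.
      δ≈g : ∀ b → Kasami.δ K 2 b ≈ g (b * b + b + 1#)
      δ≈g = solve 1 (λ b → let w = b :* b :+ b :+ con true in
        b :^ 13 :+ (b :+ con true) :^ 13 :+ con true := w :^ 5 :+ w :^ 6) refl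

      image⊆Δ₂ : ∀ {x} → ∃[ w ] x ≈ g w → Kasami.Δ K 2 x
      image⊆Δ₂ {x} (w , x≈gw) = [ w∈AS⇒ , in-coset w x≈gw ]′ (AS-index-2 w)
        where
        in-coset : ∀ w → x ≈ g w → AS (w + 1#) → Kasami.Δ K 2 x
        in-coset w x≈gw (b , w+1≈) = b , trans x≈gw (trans (g-cong
          (trans (solve 1 (λ w → w := (w :+ con true) :+ con true) refl w) (+-congʳ w+1≈))) (sym (δ≈g b)))
        -- The partner of `w` lies in the other coset: w′ + 1 = (w′ + w + 1) + w is a sum of two
        -- elements of `AS`.
        w∈AS⇒ : AS w → Kasami.Δ K 2 x
        w∈AS⇒ w∈AS =
          let (w′ , w′≉w , gw′≈gw) = partner w
              (b , eq) = AS-+ (collision-sum gw′≈gw w′≉w) w∈AS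
          in in-coset w′ (trans x≈gw (sym gw′≈gw))
               (b , trans (solve 2 (λ w w′ → w′ :+ con true := w′ :+ w :+ con true :+ w) refl w w′) eq)

      countEquality-±2 : ∀ {k} → + k ≡ + 2 [mod n ] ⊎ + (k ℕ.+ 2) ≡ + 0 [mod n ] →
          Kasami.CountEquality K k n
      countEquality-±2 {k} k≡±2 = countEquality partner two-of-three k
        (λ x∈Δ → let (b , eq) = proj₁ (Δ-congruent k 2 k≡±2) x∈Δ in b * b + b + 1# , trans eq (δ≈g b))
        (proj₂ (Δ-congruent k 2 k≡±2) ∘ image⊆Δ₂)

    -- Such a `b` satisfies b⁴ = b, so `φ 2` fixes it, and then `φ k` does because k ≡ ±2.
    -- Coprimality forces b² = b, whence 1 = b² + b = 0.
    no-cube-root : ∀ {k} → gcd k n ≡ 1 → + k ≡ + 2 [mod n ] ⊎ + (k ℕ.+ 2) ≡ + 0 [mod n ] → ∀ b →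
        b * b + b ≉ 1#
    no-cube-root {k} coprime k≡±2 b eq = 1≉0
        (trans (sym eq) (x≈y⇒x+y≈0 (φ-coprime-fixed {k} coprime {b} φkb≈b)))
      where
      b²≈b+1 : b * b ≈ b + 1#
      b²≈b+1 = trans (solve 1 (λ b → b :* b := b :+ (b :* b :+ b)) refl b) (+-congˡ eq)
      φ2b≈b : φ 2 b ≈ b
      φ2b≈b = begin
        φ 2 b                        ≈⟨ solve 1 (λ b → b :^ 4 := (b :* b) :* (b :* b)) refl b ⟩
        (b * b) * (b * b)            ≈⟨ *-cong b²≈b+1 b²≈b+1 ⟩
        (b + 1#) * (b + 1#)
          ≈⟨ solve 1 (λ b → (b :+ con true) :* (b :+ con true) := b :* b :+ con true) refl b ⟩
        b * b + 1#                   ≈⟨ +-congʳ b²≈b+1 ⟩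
        b + 1# + 1#                  ≈⟨ solve 1 (λ b → b :+ con true :+ con true := b) refl b ⟩
        b                            ∎
      φkb≈b : φ k b ≈ b
      φkb≈b = [ (λ k≡2 → trans (φ-mod k 2 k≡2 b) φ2b≈b)
              , (λ k+2≡0 → trans (φ-cong k (sym φ2b≈b))
                  (trans (φ-∘ 2 k b) (trans (^-congʳ b (≡.cong (2 ℕ.^_) (ℕ.+-comm 2 k)))
                  (trans (φ-mod (k ℕ.+ 2) 0 k+2≡0 b) (*-identityʳ b))))) ]′ k≡±2

-- Congruences modulo `n` and the final case split.

open import Data.Integer.Base using (-_; _-_)
open import Data.Nat.Base using (_^_; _<_)

-- Serves both representatives of the residue of -j, namely `- j` and `n - j`: each gives a multiple
-- of `n` when `j` is added.
≡[mod]-shift : ∀ {n} k j {a} → + n Signed.∣ a ℤ.+ + j → + k ≡ a [mod n ] → + (k ℕ.+ j) ≡ + 0 [mod n ]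
≡[mod]-shift {n} k j {a} a+j k≡a = Signed.∣⇒∣ᵤ (≡.subst (+ n Signed.∣_) (regroup (+ k) a (+ j))
    (Signed.∣m∣n⇒∣m+n (Signed.∣ᵤ⇒∣ {+ n} {+ k - a} k≡a) a+j))
  where
  regroup : ∀ k a j → k - a ℤ.+ (a ℤ.+ j) ≡ k ℤ.+ j - + 0
  regroup = solve-∀

≡-j⇒ : ∀ {n} k j → + k ≡ - + j [mod n ] → + (k ℕ.+ j) ≡ + 0 [mod n ]
≡-j⇒ {n} k j = ≡[mod]-shift {n} k j {a = - + j}
    (≡.subst (+ n Signed.∣_) (≡.sym (ℤ.+-inverseˡ (+ j))) (Signed.divides (+ 0) (≡.sym (ℤ.*-zeroˡ (+ n)))))

≡n-j⇒ : ∀ {n} k j → + k ≡ + n - + j [mod n ] → + (k ℕ.+ j) ≡ + 0 [mod n ]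
≡n-j⇒ {n} k j = ≡[mod]-shift {n} k j {+ n - + j}
    (≡.subst (+ n Signed.∣_) (cancel (+ n) (+ j)) Signed.∣-refl)
  where
  cancel : ∀ n j → n ≡ n - j ℤ.+ j
  cancel = solve-∀

corollary11p12 : {c ℓ₁ ℓ₂ : Level} (k n : ℕ) → 0 < k → 0 < n → gcd k n ≡ 1 →
    (K : HeytingField c ℓ₁ ℓ₂) →
    HasCardinality (CommutativeRing.setoid (commutativeRing K)) (2 ^ n) →
    ((+ k ≡ + 2 [mod n ] ⊎ + k ≡ - (+ 2) [mod n ]) →
    Kasami.CountEquality K k n)
    ×
    ((+ k ≡ + 1 [mod n ] ⊎ + k ≡ + 2 [mod n ]
    ⊎ + k ≡ + n - + 2 [mod n ] ⊎ + k ≡ + n - + 1 [mod n ]) →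
    Kasami.CountEquality K k n)
corollary11p12 k n _ 0<n coprime K fin =
  [ ±2 ∘ inj₁ , ±2 ∘ inj₂ ∘ ≡-j⇒ {n} k 2 ]′ ,
  [ ±1 ∘ inj₁ , [ ±2 ∘ inj₁ , [ ±2 ∘ inj₂ ∘ ≡n-j⇒ {n} k 2 , ±1 ∘ inj₂ ∘ ≡n-j⇒ {n} k 1 ]′ ]′ ]′
  where
  open FiniteFieldOfChar2.KasamiImages K n 0<n fin
  ±1 : + k ≡ + 1 [mod n ] ⊎ + (k ℕ.+ 1) ≡ + 0 [mod n ] → Kasami.CountEquality K k n
  ±1 = Quadratic.countEquality-±1
  ±2 : + k ≡ + 2 [mod n ] ⊎ + (k ℕ.+ 2) ≡ + 0 [mod n ] → Kasami.CountEquality K k n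
  ±2 k≡±2 = Sextic.countEquality-±2 (no-cube-root coprime k≡±2) k≡±2
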